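{- Let $G$ be a $(P_5,\textit{HVN})$-free graph that contains an induced $T$-5-wheel. Then $\chi(G)\leq\omega(G)+3$.
   Context: Graphs are finite, simple and connected. $P_5$ is the path on 5 vertices; an HVN is a $K_4$ plus a vertex adjacent to exactly two vertices of the $K_4$; $(H_1,H_2)$-free means no induced $H_1$ or $H_2$. A $T$-5-wheel is a chordless 5-cycle $v_1v_2v_3v_4v_5v_1$ together with an additional vertex adjacent to exactly three consecutive vertices of the cycle (e.g. $v_5,v_1,v_2$). $\chi$ and $\omega$ denote chromatic and clique number. -}

module Defs where

open import Data.Nat using (ℕ; zero; suc; _+_)
open import Data.Fin using (Fin; toℕ; inject₁; fromℕ)
import Data.Fin as F
open import Data.Bool using (Bool; true; false; _∨_; _∧_)
open import Data.List using (List; []; _∷_)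
open import Data.Bool.ListAction using (any)
open import Data.Product using (Σ; _×_; _,_; ∃)
open import Relation.Binary.PropositionalEquality using (_≡_; _≢_; refl; cong₂)
open import Data.Bool.Properties using (∨-comm)
open import Function.Definitions using (Injective)
import Data.Nat as N

record Graph (n : ℕ) : Set where
  field
    adj   : Fin n → Fin n → Bool
    sym   : ∀ u v → adj u v ≡ adj v u
    irrefl : ∀ u → adj u u ≡ false
open Graph public

Walk : ∀ {n} → Graph n → Fin n → Fin n → Set
Walk {n} G u v =
  Σ ℕ λ k → Σ (Fin (suc k) → Fin n) λ w →
    (w F.zero ≡ u) × (w (fromℕ k) ≡ v) ×
    (∀ (i : Fin k) → adj G (w (inject₁ i)) (w (F.suc i)) ≡ true)

Connected : ∀ {n} → Graph n → Set
Connected G = ∀ u v → Walk G u v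

InducedSub : ∀ {m n} → Graph m → Graph n → Set
InducedSub {m} {n} H G =
  Σ (Fin m → Fin n) λ f → Injective _≡_ _≡_ f ×
    (∀ i j → adj H i j ≡ adj G (f i) (f j))

Free : ∀ {m n} → Graph m → Graph n → Set
Free H G = InducedSub H G → Data.Empty.⊥
  where import Data.Empty

IsClique : ∀ {n k} → Graph n → (Fin k → Fin n) → Set
IsClique G f = Injective _≡_ _≡_ f × (∀ i j → i ≢ j → adj G (f i) (f j) ≡ true)

HasClique : ∀ {n} → Graph n → ℕ → Set
HasClique {n} G k = Σ (Fin k → Fin n) λ f → IsClique G f

IsCliqueNumber : ∀ {n} → Graph n → ℕ → Set
IsCliqueNumber G ω = HasClique G ω × (HasClique G (suc ω) → Data.Empty.⊥)
  where import Data.Empty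

Colouring : ∀ {n} → Graph n → ℕ → Set
Colouring {n} G k = Σ (Fin n → Fin k) λ c → ∀ u v → adj G u v ≡ true → c u ≢ c v

ChiLe : ∀ {n} → Graph n → ℕ → Set
ChiLe G k = Colouring G k

private
  eqℕ : ℕ → ℕ → Bool
  eqℕ zero zero = true
  eqℕ (suc a) (suc b) = eqℕ a b
  eqℕ _ _ = false

  edgeIn : List (ℕ × ℕ) → ℕ → ℕ → Bool
  edgeIn es a b = any (λ { (x , y) → (eqℕ x a ∧ eqℕ y b) ∨ (eqℕ x b ∧ eqℕ y a) }) es

  edgeIn-sym : ∀ es a b → edgeIn es a b ≡ edgeIn es b a
  edgeIn-sym [] a b = refl
  edgeIn-sym ((x , y) ∷ es) a b =
    cong₂ _∨_ (∨-comm (eqℕ x a ∧ eqℕ y b) (eqℕ x b ∧ eqℕ y a)) (edgeIn-sym es a b)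

fromEdges : ∀ k → List (ℕ × ℕ) → Fin k → Fin k → Bool
fromEdges k es i j = edgeIn es (toℕ i) (toℕ j)

fromEdges-sym : ∀ k es (i j : Fin k) → fromEdges k es i j ≡ fromEdges k es j i
fromEdges-sym k es i j = edgeIn-sym es (toℕ i) (toℕ j)

p5E : List (ℕ × ℕ)
p5E = (0 , 1) ∷ (1 , 2) ∷ (2 , 3) ∷ (3 , 4) ∷ []

hvnE : List (ℕ × ℕ)
hvnE = (0 , 1) ∷ (0 , 2) ∷ (0 , 3) ∷ (1 , 2) ∷ (1 , 3) ∷ (2 , 3)
                     ∷ (4 , 0) ∷ (4 , 1) ∷ []

twE : List (ℕ × ℕ)
twE = (0 , 1) ∷ (1 , 2) ∷ (2 , 3) ∷ (3 , 4) ∷ (4 , 0)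
                    ∷ (5 , 4) ∷ (5 , 0) ∷ (5 , 1) ∷ []

p5Adj : Fin 5 → Fin 5 → Bool
p5Adj = fromEdges 5 p5E


-- HVN: K4 on {0,1,2,3}, plus vertex 4 adjacent to exactly 0 and 1
hvnAdj : Fin 5 → Fin 5 → Bool
hvnAdj = fromEdges 5 hvnE


-- T-5-wheel: chordless 5-cycle 0-1-2-3-4-0, plus vertex 5 adjacent to exactly 4,0,1
twAdj : Fin 6 → Fin 6 → Bool
twAdj = fromEdges 6 twE


P5 : Graph 5
P5 = record { adj = p5Adj ; sym = fromEdges-sym 5 p5E ; irrefl = irr }
  where
  irr : ∀ u → p5Adj u u ≡ false
  irr F.zero = refl
  irr (F.suc F.zero) = refl
  irr (F.suc (F.suc F.zero)) = refl
  irr (F.suc (F.suc (F.suc F.zero))) = refl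
  irr (F.suc (F.suc (F.suc (F.suc F.zero)))) = refl

HVN : Graph 5
HVN = record { adj = hvnAdj ; sym = fromEdges-sym 5 hvnE ; irrefl = irr }
  where
  irr : ∀ u → hvnAdj u u ≡ false
  irr F.zero = refl
  irr (F.suc F.zero) = refl
  irr (F.suc (F.suc F.zero)) = refl
  irr (F.suc (F.suc (F.suc F.zero))) = refl
  irr (F.suc (F.suc (F.suc (F.suc F.zero)))) = refl

T5Wheel : Graph 6
T5Wheel = record { adj = twAdj ; sym = fromEdges-sym 6 twE ; irrefl = irr }
  where
  irr : ∀ u → twAdj u u ≡ false
  irr F.zero = refl
  irr (F.suc F.zero) = refl
  irr (F.suc (F.suc F.zero)) = refl
  irr (F.suc (F.suc (F.suc F.zero))) = refl
  irr (F.suc (F.suc (F.suc (F.suc F.zero)))) = refl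
  irr (F.suc (F.suc (F.suc (F.suc (F.suc F.zero))))) = refl

-- Neighbourhoods are paw-free and P5-free, so N(w) is max(3, ω − 1)-colourable.  Name the T-5-wheel as an
-- induced path v₂v₃v₄v₅ and an edge pq complete to {v₂, v₅} and anticomplete to {v₃, v₄}.  A vertex outside
-- U = N(v₂) lies in I = (N(p) ∩ N(q)) \ (N(v₂) ∪ N(v₅)), in R = (N(v₃) ∩ N(v₅)) \ N(v₂), or in the set Z of
-- vertices that see nothing of the wheel.  The set I is independent, and a vertex outside Z is complete or
-- anticomplete to each component of Z.
--
-- If R is independent and ω ≥ 4, the neighbours of Z lie in I and in two independent subsets S₁, S₂ of U.
-- Removing I, R, S₁, S₂ leaves a graph each of whose components lies in some N(w): ω − 1 + 4 colours.  If
-- ω = 3, U takes 3 colours, I and R one each, and a component of Z takes the sixth and two of these that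
-- its neighbours do not use.  The same applies to the mirrored wheel if R* = (N(v₄) ∩ N(v₂)) \ N(v₅) is independent.  Otherwise some r in R and s in R* are
-- non-adjacent, since two edges complete to each other form an HVN with v₅.  Then, up to exchanging p and q,
-- r sees p and s sees q, which forces Z to be empty and both R ∩ N(p) and R \ N(p) to be independent, so
-- max(3, ω − 1) + 3 colours suffice.

module Submission where

open import Defs
open import Data.Nat using (ℕ; _+_)
open import Data.Product using (_×_)
open import Data.Bool.Base using (Bool; true; false; not; _∧_; _∨_; if_then_else_)
import Data.Bool.Properties as Bool
open import Data.Fin.Base using (Fin; zero; suc; inject≤; fromℕ; inject₁; toℕ)
open import Data.Fin using (#_)
import Data.Fin.Properties as Fin
open import Data.Fin.Subset using (Subset; _⊂_)
open import Data.Fin.Subset.Properties using (anySubset?)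
open import Data.Fin.Subset.Induction using (⊂-wellFounded)
open import Data.List.Base as List using (List; []; _∷_; _++_)
open import Data.List.Membership.Propositional using (_∈_)
import Data.List.Membership.DecPropositional as DecPropositional
open import Data.List.Relation.Unary.All as All using (All; []; _∷_)
import Data.List.Relation.Unary.All.Properties as All
open import Data.Nat.Base using (zero; suc; _≤_; z≤n; s≤s)
import Data.Nat.Properties as ℕ
open import Data.Product.Base using (∃; ∃₂; _,_; proj₁; proj₂)
open import Data.Product.Properties using (≡-dec)
open import Data.Sum.Base using (_⊎_; inj₁; inj₂; [_,_]′)
open import Data.Unit.Base using (⊤; tt)
open import Data.Empty using (⊥; ⊥-elim)
open import Data.Vec.Base as Vec using (Vec; []; _∷_)
import Data.Vec.Properties as Vec
open import Function.Base using (_∘_; case_of_)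
open import Function.Definitions using (Injective)
open import Induction.WellFounded using (Acc; acc)
open import Relation.Nullary using (¬_; Dec; yes; no; does)
open import Relation.Nullary.Decidable
  using (True; toWitness; from-yes; _×-dec_; _⊎-dec_; _→-dec_; ¬?; decidable-stable; dec-true; dec-false)
open import Relation.Binary.PropositionalEquality
  using (_≡_; _≢_; refl; trans; cong; cong₂; subst) renaming (sym to ≡-sym)

true≢false : ∀ {b} → b ≡ true → b ≡ false → ⊥
true≢false refl ()

≢true⇒≡false : ∀ {b} → b ≢ true → b ≡ false
≢true⇒≡false = Bool.¬-not

does-true : ∀ {A : Set} (a? : Dec A) → does a? ≡ true → A
does-true (yes a) _ = a

does-false : ∀ {A : Set} (a? : Dec A) → does a? ≡ false → ¬ A
does-false (no ¬a) _ = ¬a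

-- A certificate that a partially known graph, with vertices numbered by ℕ, has no completion free of P5
-- and HVN: a decision tree over unknown pairs whose leaves list an induced copy in the vertex order of Defs.

Fact : Set
Fact = ℕ × ℕ × Bool

infix 6 _∼_ _≁_

pattern _∼_ i j = i , j , true
pattern _≁_ i j = i , j , false

data Refutation : Set where
  p5 hvn : (a b c d e : ℕ) → Refutation
  split : (i j : ℕ) → Refutation → Refutation → Refutation

-- A fact may be recorded in either order of its pair; the diagonal is exempt, since `irrefl`
-- supplies it.
Copy : Graph 5 → Vec ℕ 5 → List Fact → Set
Copy H σ fs = ∀ i j → i ≡ j ⊎
  (Vec.lookup σ i , Vec.lookup σ j , adj H i j) ∈ fs ⊎ (Vec.lookup σ j , Vec.lookup σ i , adj H i j) ∈ fs

Refutes : Refutation → List Fact → Set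
Refutes (p5 a b c d e) = Copy P5 (a ∷ b ∷ c ∷ d ∷ e ∷ [])
Refutes (hvn a b c d e) = Copy HVN (a ∷ b ∷ c ∷ d ∷ e ∷ [])
Refutes (split i j r s) fs = Refutes r (i ∼ j ∷ fs) × Refutes s (i ≁ j ∷ fs)

private
  _∈?_ : (f : Fact) (fs : List Fact) → Dec (f ∈ fs)
  _∈?_ = DecPropositional._∈?_ (≡-dec ℕ._≟_ (≡-dec ℕ._≟_ Bool._≟_))

copy? : ∀ H σ fs → Dec (Copy H σ fs)
copy? H σ fs = Fin.all? λ i → Fin.all? λ j → i Fin.≟ j ⊎-dec (_ ∈? fs) ⊎-dec (_ ∈? fs)

refutes? : ∀ r fs → Dec (Refutes r fs)
refutes? (p5 a b c d e) = copy? P5 (a ∷ b ∷ c ∷ d ∷ e ∷ [])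
refutes? (hvn a b c d e) = copy? HVN (a ∷ b ∷ c ∷ d ∷ e ∷ [])
refutes? (split i j r s) fs = refutes? r _ ×-dec refutes? s _

-- Makes injectivity of an induced copy automatic.
NoFalseTwins : ∀ {m} → Graph m → Set
NoFalseTwins H = ∀ i j → (∀ k → adj H i k ≡ adj H j k) → adj H i j ≡ false → i ≡ j

noFalseTwins? : ∀ {m} (H : Graph m) → Dec (NoFalseTwins H)
noFalseTwins? H = Fin.all? λ i → Fin.all? λ j →
  Fin.all? (λ k → adj H i k Bool.≟ adj H j k) →-dec adj H i j Bool.≟ false →-dec i Fin.≟ j

nth : {A : Set} → A → List A → ℕ → A
nth d [] _ = d
nth d (x ∷ _) zero = x
nth d (_ ∷ xs) (suc k) = nth d xs k

-- Vertices 0, …, 4 of the T-5-wheel are the cycle p, v₂, v₃, v₄, v₅, and 5 is the twin q of p.  The primed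
-- numbers name them in certificates; x′, y′, z′, w′ are additional vertices.

pattern p′ = 0
pattern 2′ = 1
pattern 3′ = 2
pattern 4′ = 3
pattern 5′ = 4
pattern q′ = 5
pattern x′ = 6
pattern y′ = 7
pattern z′ = 8
pattern w′ = 9

module _ {n : ℕ} (G : Graph n) where

  private
    V = Fin n
    _~_ = adj G

  ~-sym : ∀ {u v b} → u ~ v ≡ b → v ~ u ≡ b
  ~-sym {u} {v} e = trans (sym G v u) e

  ~⇒≢ : ∀ {u v} → u ~ v ≡ true → u ≢ v
  ~⇒≢ {u} e refl = true≢false e (irrefl G u)

  VSet : Set
  VSet = V → Bool

  infix 4 _∈ˢ_ _∉ˢ_ _⊆ˢ_

  _∈ˢ_ _∉ˢ_ : V → VSet → Set
  x ∈ˢ S = S x ≡ true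
  x ∉ˢ S = S x ≡ false

  full : VSet
  full _ = true

  infixl 6 _∖_ _∩_

  _∖_ _∩_ : VSet → VSet → VSet
  (S ∖ T) x = S x ∧ not (T x)
  (S ∩ T) x = S x ∧ T x

  _⊆ˢ_ : VSet → VSet → Set
  S ⊆ˢ T = ∀ {x} → x ∈ˢ S → x ∈ˢ T

  ∈∖ : ∀ {S T x} → x ∈ˢ S → x ∉ˢ T → x ∈ˢ S ∖ T
  ∈∖ p q rewrite p | q = refl

  ∈∖⁻ : ∀ {S T x} → x ∈ˢ S ∖ T → x ∈ˢ S × x ∉ˢ T
  ∈∖⁻ {S} {T} {x} p with S x | T x | p
  ... | true | false | _ = refl , refl

  ∈∩ : ∀ {S T x} → x ∈ˢ S → x ∈ˢ T → x ∈ˢ S ∩ T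
  ∈∩ p q rewrite p | q = refl

  ∈∩⁻ : ∀ {S T x} → x ∈ˢ S ∩ T → x ∈ˢ S × x ∈ˢ T
  ∈∩⁻ {S} {T} {x} p with S x | T x | p
  ... | true | true | _ = refl , refl

  ∉∩ : ∀ {S T x} → x ∈ˢ S → x ∉ˢ S ∩ T → x ∉ˢ T
  ∉∩ {S} {T} {x} p q with S x | T x | p
  ... | true | false | _ = refl

  ∉∖ : ∀ {S T x} → x ∈ˢ S → x ∉ˢ S ∖ T → x ∈ˢ T
  ∉∖ {S} {T} {x} p q with S x | T x | p
  ... | true | true | _ = refl

  -- Connectivity

  Separates : VSet → VSet → Set
  Separates T S = (∃ λ x → x ∈ˢ S × x ∈ˢ T) × (∃ λ x → x ∈ˢ S × x ∉ˢ T) ×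
    (∀ x y → x ∈ˢ S → y ∈ˢ S → x ∈ˢ T → y ∉ˢ T → x ~ y ≡ false)

  -- Phrased by cuts, so the empty set counts as connected; this is the source of the later case
  -- splits on emptiness.
  Conn : VSet → Set
  Conn S = ∀ T → ¬ Separates T S

  private
    infix 4 _≟_
    _≟_ = Bool._≟_

  separates? : ∀ T S → Dec (Separates T S)
  separates? T S =
    Fin.any? (λ x → S x ≟ true ×-dec T x ≟ true) ×-dec
    Fin.any? (λ x → S x ≟ true ×-dec T x ≟ false) ×-dec
    Fin.all? λ x → Fin.all? λ y →
      S x ≟ true →-dec S y ≟ true →-dec T x ≟ true →-dec T y ≟ false →-dec x ~ y ≟ false

  separates-cong : ∀ {T T′ S} → (∀ x → T x ≡ T′ x) → Separates T S → Separates T′ S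
  separates-cong eq ((x , p , q) , (y , r , s) , t) =
    (x , p , trans (≡-sym (eq x)) q) , (y , r , trans (≡-sym (eq y)) s) ,
    λ x y p q r s → t x y p q (trans (eq x) r) (trans (eq y) s)

  -- Cuts are functions, while `anySubset?` searches vectors; `separates-cong` passes from a
  -- function to its tabulation.
  conn⊎separates : ∀ S → Conn S ⊎ ∃ λ T → Separates T S
  conn⊎separates S with anySubset? (λ T → separates? (Vec.lookup T) S)
  ... | yes (T , sep) = inj₂ (Vec.lookup T , sep)
  ... | no ¬sep = inj₁ λ T sep →
    ¬sep (Vec.tabulate T , separates-cong (λ x → ≡-sym (Vec.lookup∘tabulate T x)) sep)

  Crossing : VSet → VSet → Set
  Crossing T S = ∃₂ λ x y → x ∈ˢ S × y ∈ˢ S × x ∈ˢ T × y ∉ˢ T × x ~ y ≡ true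

  crossing : ∀ {S} → Conn S → ∀ T {x y} → x ∈ˢ S → x ∈ˢ T → y ∈ˢ S → y ∉ˢ T → Crossing T S
  crossing {S} conn T {x} {y} p q r s
    with Fin.any? (λ x → Fin.any? λ y →
      S x ≟ true ×-dec S y ≟ true ×-dec T x ≟ true ×-dec T y ≟ false ×-dec x ~ y ≟ true)
  ... | yes c = c
  ... | no ¬c = ⊥-elim (conn T ((x , p , q) , (y , r , s) ,
    λ x y p q r s → ≢true⇒≡false λ e → ¬c (x , y , p , q , r , s , e)))

  walk-crossing : ∀ T {u v} → Walk G u v → u ∈ˢ T → v ∉ˢ T →
    ∃₂ λ x y → x ∈ˢ T × y ∉ˢ T × x ~ y ≡ true
  walk-crossing T (k , w , refl , refl , e) p q = go k w e p q
    where
    go : ∀ k (w : Fin (suc k) → V) → (∀ (i : Fin k) → w (inject₁ i) ~ w (suc i) ≡ true) →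
      w zero ∈ˢ T → w (fromℕ k) ∉ˢ T → ∃₂ λ x y → x ∈ˢ T × y ∉ˢ T × x ~ y ≡ true
    go zero w e p q = ⊥-elim (true≢false p q)
    go (suc k) w e p q with T (w (suc zero)) in eq
    ... | true = go k (w ∘ suc) (e ∘ suc) eq q
    ... | false = _ , _ , p , eq , e zero

  -- List colourings

  -- `L x c` allows colour `c` at `x`. The colour function is total and arbitrary outside `S`, so
  -- colourings of two sets combine by a membership test.
  record Colours {C : Set} (S : VSet) (L : V → C → Set) : Set where
    field
      colour : V → C
      listed : ∀ {x} → x ∈ˢ S → L x (colour x)
      proper : ∀ {x y} → x ∈ˢ S → y ∈ˢ S → x ~ y ≡ true → colour x ≢ colour y
  open Colours public

  -- For `D ⊆ˢ S` this makes `D` a union of components of `S`.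
  Closed : VSet → VSet → Set
  Closed D S = ∀ {x y} → x ∈ˢ D → y ∈ˢ S → y ∉ˢ D → x ~ y ≡ false

  colours-⊆ : ∀ {C S T} {L : V → C → Set} → S ⊆ˢ T → Colours T L → Colours S L
  colours-⊆ sub c = record
    { colour = colour c ; listed = listed c ∘ sub ; proper = λ p q → proper c (sub p) (sub q) }

  relist : ∀ {C S} {L M : V → C → Set} → (∀ {x c} → x ∈ˢ S → L x c → M x c) → Colours S L → Colours S M
  relist f c = record { colour = colour c ; listed = λ p → f p (listed c p) ; proper = proper c }

  no-vertex : ∀ {m S} {L : V → Fin (suc m) → Set} → (∀ {x} → ¬ x ∈ˢ S) → Colours S L
  no-vertex none = record
    { colour = λ _ → zero ; listed = λ p → ⊥-elim (none p) ; proper = λ p → ⊥-elim (none p) }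

  glue : ∀ {C S} {L : V → C → Set} T → Closed (S ∩ T) S →
    Colours (S ∩ T) L → Colours (S ∖ T) L → Colours S L
  glue {C} {S} {L} T closed c d = record { colour = col ; listed = lis ; proper = pro }
    where
    col : V → C
    col x = if T x then colour c x else colour d x
    lis : ∀ {x} → x ∈ˢ S → L x (col x)
    lis {x} p with T x in eq
    ... | true = listed c (∈∩ {S} {T} p eq)
    ... | false = listed d (∈∖ {S} {T} p eq)
    apart : ∀ {x y} → x ∈ˢ S → y ∈ˢ S → x ∈ˢ T → y ∉ˢ T → x ~ y ≡ true → ⊥
    apart {x} {y} p q r s e = true≢false e
      (closed (∈∩ {S} {T} p r) q (trans (Bool.∧-comm (S y) (T y)) (cong (_∧ S y) s)))
    pro : ∀ {x y} → x ∈ˢ S → y ∈ˢ S → x ~ y ≡ true → col x ≢ col y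
    pro {x} {y} p q e with T x in eqx | T y in eqy
    ... | true | true = proper c (∈∩ {S} {T} p eqx) (∈∩ {S} {T} q eqy) e
    ... | true | false = ⊥-elim (apart p q eqx eqy e)
    ... | false | true = ⊥-elim (apart q p eqy eqx (~-sym e))
    ... | false | false = proper d (∈∖ {S} {T} p eqx) (∈∖ {S} {T} q eqy) e

  extend : ∀ {C} {Z : VSet} (c₀ : V → C) →
    (∀ {x y} → x ∉ˢ Z → y ∉ˢ Z → x ~ y ≡ true → c₀ x ≢ c₀ y) →
    Colours Z (λ z c → ∀ {w} → w ∉ˢ Z → w ~ z ≡ true → c₀ w ≢ c) →
    Colours {C} full (λ _ _ → ⊤)
  extend {C} {Z} c₀ pro₀ cZ = record { colour = col ; listed = λ _ → tt ; proper = pro }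
    where
    col : V → C
    col x = if Z x then colour cZ x else c₀ x
    pro : ∀ {x y} → x ∈ˢ full → y ∈ˢ full → x ~ y ≡ true → col x ≢ col y
    pro {x} {y} _ _ e with Z x in a | Z y in b
    ... | true | true = proper cZ a b e
    ... | true | false = λ h → listed cZ a b (~-sym e) (≡-sym h)
    ... | false | true = listed cZ b a e
    ... | false | false = pro₀ a b e

  toSubset : VSet → Subset n
  toSubset = Vec.tabulate

  toSubset-⊂ : ∀ {S T} → T ⊆ˢ S → ∀ {x} → x ∈ˢ S → x ∉ˢ T → toSubset T ⊂ toSubset S
  toSubset-⊂ {S} {T} sub {x} p q =
    (λ {y} r → Vec.lookup⇒[]= y (toSubset S)
      (trans (Vec.lookup∘tabulate S y)
        (sub (trans (≡-sym (Vec.lookup∘tabulate T y)) (Vec.[]=⇒lookup r))))) ,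
    x , Vec.lookup⇒[]= x (toSubset S) (trans (Vec.lookup∘tabulate S x) p) ,
    λ r → true≢false (trans (≡-sym (Vec.lookup∘tabulate T x)) (Vec.[]=⇒lookup r)) q

  -- Induction on strict inclusion: a cut leaves two smaller parts, again closed in `S`, whose
  -- colourings glue because no edge joins them. A set without a cut goes to `f`; it can be empty.
  by-components : ∀ {C} {L : V → C → Set} S →
    (∀ D → D ⊆ˢ S → Conn D → Closed D S → Colours D L) → Colours S L
  by-components {C} {L} S₀ f = go S₀ (⊂-wellFounded _) (λ p → p) λ _ q r → ⊥-elim (true≢false q r)
    where
    go : ∀ S → Acc _⊂_ (toSubset S) → S ⊆ˢ S₀ → Closed S S₀ → Colours S L
    go S (acc rec) sub closed with conn⊎separates S
    ... | inj₁ conn = f S sub conn closed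
    ... | inj₂ (T , (x , p , q) , (y , r , s) , sep) =
      glue T cl∩
        (go (S ∩ T) (rec (toSubset-⊂ (proj₁ ∘ ∈∩⁻ {S} {T}) r
            (trans (Bool.∧-comm (S y) (T y)) (cong (_∧ S y) s))))
          (sub ∘ proj₁ ∘ ∈∩⁻ {S} {T}) (lift (S ∩ T) (proj₁ ∘ ∈∩⁻ {S} {T}) cl∩))
        (go (S ∖ T) (rec (toSubset-⊂ (proj₁ ∘ ∈∖⁻ {S} {T}) p
            (trans (Bool.∧-comm (S x) (not (T x))) (cong (λ b → not b ∧ S x) q))))
          (sub ∘ proj₁ ∘ ∈∖⁻ {S} {T}) (lift (S ∖ T) (proj₁ ∘ ∈∖⁻ {S} {T}) cl∖))
      where
      cl∩ : Closed (S ∩ T) S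
      cl∩ p q r = let p₁ , p₂ = ∈∩⁻ {S} {T} p in sep _ _ p₁ q p₂ (∉∩ {S} {T} q r)
      cl∖ : Closed (S ∖ T) S
      cl∖ p q r = let p₁ , p₂ = ∈∖⁻ {S} {T} p in ~-sym (sep _ _ q p₁ (∉∖ {S} {T} q r) p₂)
      lift : ∀ D → D ⊆ˢ S → Closed D S → Closed D S₀
      lift D sub cl {x} {y} p q r with S y in eq
      ... | true = cl p eq r
      ... | false = closed (sub p) q eq

  -- Cliques

  infix 4 _has-clique_

  -- Choosing vertices one at a time in shrinking common neighbourhoods relativises cliques to a
  -- vertex set and makes them decidable by recursion on the size.
  _has-clique_ : VSet → ℕ → Set
  S has-clique zero = ⊤
  S has-clique suc k = ∃ λ x → x ∈ˢ S × S ∩ (x ~_) has-clique k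

  clique-⊆ : ∀ {S T} k → S ⊆ˢ T → S has-clique k → T has-clique k
  clique-⊆ zero sub _ = tt
  clique-⊆ {S} {T} (suc k) sub (x , p , c) = x , sub p ,
    clique-⊆ k (λ q → let r , s = ∈∩⁻ {S} {x ~_} q in ∈∩ {T} {x ~_} (sub r) s) c

  clique⇒HasClique : ∀ {S} k → S has-clique k →
    ∃ λ (f : Fin k → V) → IsClique G f × (∀ i → f i ∈ˢ S)
  clique⇒HasClique zero _ = (λ ()) , ((λ { {()} }) , λ ()) , λ ()
  clique⇒HasClique {S} (suc k) (x , p , c) with clique⇒HasClique k c
  ... | f , (inj , all) , inS = g , (g-inj , g-all) , g-in
    where
    g : Fin (suc k) → V
    g zero = x
    g (suc i) = f i
    x~f : ∀ i → x ~ f i ≡ true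
    x~f i = proj₂ (∈∩⁻ {S} {x ~_} (inS i))
    g-inj : Injective _≡_ _≡_ g
    g-inj {zero} {zero} _ = refl
    g-inj {zero} {suc j} e = ⊥-elim (~⇒≢ (x~f j) e)
    g-inj {suc i} {zero} e = ⊥-elim (~⇒≢ (x~f i) (≡-sym e))
    g-inj {suc i} {suc j} e = cong suc (inj e)
    g-all : ∀ i j → i ≢ j → g i ~ g j ≡ true
    g-all zero zero ne = ⊥-elim (ne refl)
    g-all zero (suc j) ne = x~f j
    g-all (suc i) zero ne = ~-sym (x~f i)
    g-all (suc i) (suc j) ne = all i j (ne ∘ cong suc)
    g-in : ∀ i → g i ∈ˢ S
    g-in zero = p
    g-in (suc i) = proj₁ (∈∩⁻ {S} {x ~_} (inS i))

  -- Non-adjacency becomes an equivalence relation: `S` induces a complete multipartite graph.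
  NonAdjTransitive : VSet → Set
  NonAdjTransitive S = ∀ {x y z} → x ∈ˢ S → y ∈ˢ S → z ∈ˢ S →
    x ~ y ≡ false → y ~ z ≡ false → x ~ z ≡ false

  Unlisted : ∀ {C : Set} → V → C → Set
  Unlisted _ _ = ⊤

  Colourable : VSet → ℕ → Set
  Colourable S k = Colours {Fin k} S Unlisted

  Indep : VSet → Set
  Indep S = ∀ {x y} → x ∈ˢ S → y ∈ˢ S → x ~ y ≡ false

  add-class : ∀ {S} A {k} → Indep (S ∩ A) → Colourable (S ∖ A) k → Colourable S (suc k)
  add-class {S} A {k} ind c = record { colour = col ; listed = λ _ → tt ; proper = pro }
    where
    col : V → Fin (suc k)
    col x = if A x then zero else suc (colour c x)
    pro : ∀ {x y} → x ∈ˢ S → y ∈ˢ S → x ~ y ≡ true → col x ≢ col y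
    pro {x} {y} p q e with A x in eqx | A y in eqy
    ... | true | true = λ _ → true≢false e (ind (∈∩ {S} {A} p eqx) (∈∩ {S} {A} q eqy))
    ... | true | false = λ ()
    ... | false | true = λ ()
    ... | false | false = proper c (∈∖ {S} {A} p eqx) (∈∖ {S} {A} q eqy) e ∘ Fin.suc-injective

  -- The part of a vertex `x` is a colour class, and the rest lies in the neighbourhood of `x`,
  -- where cliques are smaller by one.
  multipartite-colourable : ∀ k {S} → NonAdjTransitive S → ¬ S has-clique suc (suc k) →
    Colourable S (suc k)
  multipartite-colourable zero {S} nat ncl = record
    { colour = λ _ → zero ; listed = λ _ → tt
    ; proper = λ {x} {y} p q e _ → ncl (x , p , y , ∈∩ {S} {x ~_} q e , tt) }
  multipartite-colourable (suc k) {S} nat ncl with Fin.any? (λ x → S x ≟ true)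
  ... | no none = no-vertex λ p → none (_ , p)
  ... | yes (x , p) = add-class A ind (colours-⊆ {S = S ∖ A} {T = S ∩ (x ~_)} sub
      (multipartite-colourable k
        (λ q r s → nat (proj₁ (∈∩⁻ {S} {x ~_} q)) (proj₁ (∈∩⁻ {S} {x ~_} r)) (proj₁ (∈∩⁻ {S} {x ~_} s)))
        λ c → ncl (x , p , c)))
    where
    A : VSet
    A y = not (x ~ y)
    sub : S ∖ A ⊆ˢ S ∩ (x ~_)
    sub {y} q = subst (λ b → S y ∧ b ≡ true) (Bool.not-involutive _) q
    nonadj : ∀ {y} → y ∈ˢ A → x ~ y ≡ false
    nonadj {y} e with x ~ y | e
    ... | false | _ = refl
    ind : Indep (S ∩ A)
    ind q r with ∈∩⁻ {S} {A} q | ∈∩⁻ {S} {A} r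
    ... | q₁ , q₂ | r₁ , r₂ = nat q₁ p r₁ (~-sym (nonadj q₂)) (nonadj r₂)

  -- Paw-free neighbourhoods and triangle-free pieces

  clique? : ∀ k S → Dec (S has-clique k)
  clique? zero S = yes tt
  clique? (suc k) S = Fin.any? λ x → S x ≟ true ×-dec clique? k (S ∩ (x ~_))

  Holds : (ℕ → V) → Fact → Set
  Holds ρ (i , j , b) = ρ i ~ ρ j ≡ b

  module _ (free₁ : Free P5 G) (free₂ : Free HVN G) where

    -- Facts never assert distinctness. Positions with equal images would be false twins in `H`, so
    -- `twins` identifies them.
    no-copy : ∀ {H} → NoFalseTwins H → Free H G → ∀ ρ {fs} σ → Copy H σ fs → All (Holds ρ) fs → ⊥
    no-copy {H} twins free ρ {fs} σ copy hs = free (f , inj , agree)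
      where
      f : Fin 5 → V
      f i = ρ (Vec.lookup σ i)
      agree : ∀ i j → adj H i j ≡ f i ~ f j
      agree i j with copy i j
      ... | inj₁ refl = trans (irrefl H i) (≡-sym (irrefl G (f i)))
      ... | inj₂ (inj₁ m) = ≡-sym (All.lookup hs m)
      ... | inj₂ (inj₂ m) = ≡-sym (~-sym (All.lookup hs m))
      inj : Injective _≡_ _≡_ f
      inj {i} {j} e = twins i j
        (λ k → trans (agree i k) (trans (cong (_~ f k) e) (≡-sym (agree j k))))
        (trans (agree i j) (trans (cong (_~ f j) e) (irrefl G (f j))))

    -- Proof by reflection: evaluating `refutes?` fills the hidden argument, and the actual
    -- adjacency in `G` selects the branch of each `split`.
    refute : ∀ ρ fs r {_ : True (refutes? r fs)} → All (Holds ρ) fs → ⊥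
    refute ρ fs r {t} = go r fs (toWitness t)
      where
      go : ∀ r fs → Refutes r fs → All (Holds ρ) fs → ⊥
      go (p5 a b c d e) fs = no-copy {P5} (from-yes (noFalseTwins? P5)) free₁ ρ (a ∷ b ∷ c ∷ d ∷ e ∷ [])
      go (hvn a b c d e) fs = no-copy {HVN} (from-yes (noFalseTwins? HVN)) free₂ ρ (a ∷ b ∷ c ∷ d ∷ e ∷ [])
      go (split i j r s) fs (c , d) hs with ρ i ~ ρ j in e
      ... | true = go r _ c (e ∷ hs)
      ... | false = go s _ d (e ∷ hs)

    -- Colour N(v) with 0.  A component E of the rest has a neighbour u in N(v), and E without N(u) is
    -- independent, since an edge there would complete an induced path that starts with v, u.
    rooted-colours : ∀ {D} → Conn D → ¬ D has-clique 3 → ∀ {v} → v ∈ˢ D →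
      Colours {Fin 3} D (λ x c → v ~ x ≡ false → c ≢ zero)
    rooted-colours {D} conn ntri {v} v∈D = record
      { colour = col ; listed = lis ; proper = pro }
      where
      B : VSet
      B = D ∖ (v ~_)
      NonZero : V → Fin 3 → Set
      NonZero _ c = c ≢ zero
      no-triangle : ∀ {x y z} → x ∈ˢ D → y ∈ˢ D → z ∈ˢ D →
        x ~ y ≡ true → x ~ z ≡ true → y ~ z ≡ true → ⊥
      no-triangle {x} {y} {z} p q r e f g = ntri (x , p , y , ∈∩ {D} {x ~_} q e , z ,
        ∈∩ {D ∩ (x ~_)} {y ~_} (∈∩ {D} {x ~_} r f) g , tt)

      -- `v` lies in `B` but sees nothing there, so its component is `v` alone.
      root-piece : ∀ E → E ⊆ˢ B → Conn E → v ∈ˢ E → Colours E NonZero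
      root-piece E sub connE v∈E = record
        { colour = λ _ → suc zero ; listed = λ _ () ; proper = λ p q e _ → lonely p q e }
        where
        isolated : ∀ {x} → x ∈ˢ E → v ~ x ≡ true → ⊥
        isolated p e = true≢false e (proj₂ (∈∖⁻ {D} {v ~_} (sub p)))
        lonely : ∀ {x y} → x ∈ˢ E → y ∈ˢ E → x ~ y ≡ true → ⊥
        lonely {x} {y} p q e with v Fin.≟ x
        ... | yes refl = isolated q e
        ... | no v≢x with crossing connE (λ u → does (v Fin.≟ u))
          v∈E (dec-true (v Fin.≟ v) refl) p (dec-false (v Fin.≟ x) v≢x)
        ... | a , b , _ , q , r , _ , e′ with does-true (v Fin.≟ a) r
        ... | refl = isolated q e′

      piece : ∀ E → E ⊆ˢ B → Conn E → Closed E B → v ∉ˢ E → ∀ {x₀} → x₀ ∈ˢ E → Colours E NonZero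
      piece E sub connE closed v∉E p
        with crossing conn E (proj₁ (∈∖⁻ {D} {v ~_} (sub p))) p v∈D v∉E
      ... | x₁ , u , _ , u∈D , x₁∈E , u∉E , x₁~u = record
        { colour = col′ ; listed = lis′ ; proper = pro′ }
        where
        E⊆D : E ⊆ˢ D
        E⊆D = proj₁ ∘ ∈∖⁻ {D} {v ~_} ∘ sub
        v≁ : ∀ {x} → x ∈ˢ E → v ~ x ≡ false
        v≁ = proj₂ ∘ ∈∖⁻ {D} {v ~_} ∘ sub
        -- `E` is closed in `B`, so its neighbour `u` outside `E` is not in `B`, hence sees `v`.
        v~u : v ~ u ≡ true
        v~u = decidable-stable (v ~ u ≟ true) λ v≁u →
          true≢false x₁~u (closed x₁∈E (∈∖ {D} {v ~_} u∈D (≢true⇒≡false v≁u)) u∉E)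
        col′ : V → Fin 3
        col′ x = if u ~ x then suc zero else suc (suc zero)
        lis′ : ∀ {x} → x ∈ˢ E → col′ x ≢ zero
        lis′ {x} _ with u ~ x
        ... | true = λ ()
        ... | false = λ ()
        -- The deep vertices of `E` are the ends of its edges that avoid the neighbours of `u`. As
        -- `x₁` is not deep, the existence of a deep vertex gives an edge from a deep `a`, with
        -- partner `a′`, to a `b` that is not deep. Then `b` sees `u`, and either `a`, `b`, `a′` is
        -- a triangle or `v`, `u`, `b`, `a`, `a′` is an induced path.
        Deep : V → Set
        Deep x = u ~ x ≡ false × ∃ λ y → y ∈ˢ E × u ~ y ≡ false × x ~ y ≡ true
        deep? : ∀ x → Dec (Deep x)
        deep? x = u ~ x ≟ false ×-dec Fin.any? λ y → E y ≟ true ×-dec u ~ y ≟ false ×-dec x ~ y ≟ true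
        no-edge : ∀ {x y} → x ∈ˢ E → y ∈ˢ E → u ~ x ≡ false → u ~ y ≡ false → x ~ y ≡ true → ⊥
        no-edge {x} {y} p q e f g
          with crossing connE (does ∘ deep?) p (dec-true (deep? x) (e , y , q , f , g))
                 x₁∈E (dec-false (deep? x₁) λ (h , _) → true≢false (~-sym x₁~u) h)
        ... | a , b , a∈E , b∈E , a-deep , b-shallow , a~b with does-true (deep? a) a-deep | u ~ b ≟ true
        ... | u≁a , _ | no u≁b = does-false (deep? b) b-shallow (≢true⇒≡false u≁b , a , a∈E , u≁a , ~-sym a~b)
        ... | u≁a , a′ , a′∈E , u≁a′ , a~a′ | yes u~b with b ~ a′ in b~a′
        ... | true = no-triangle (E⊆D a∈E) (E⊆D b∈E) (E⊆D a′∈E) a~b a~a′ b~a′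
        ... | false = refute (nth v (v ∷ u ∷ b ∷ a ∷ a′ ∷ []))
          (0 ∼ 1 ∷ 0 ≁ 2 ∷ 0 ≁ 3 ∷ 0 ≁ 4 ∷ 1 ∼ 2 ∷ 1 ≁ 3 ∷ 1 ≁ 4 ∷ 2 ∼ 3 ∷ 2 ≁ 4 ∷ 3 ∼ 4 ∷ [])
          (p5 0 1 2 3 4)
          (v~u ∷ v≁ b∈E ∷ v≁ a∈E ∷ v≁ a′∈E ∷ u~b ∷ u≁a ∷ u≁a′ ∷ ~-sym a~b ∷ b~a′ ∷ a~a′ ∷ [])
        pro′ : ∀ {x y} → x ∈ˢ E → y ∈ˢ E → x ~ y ≡ true → col′ x ≢ col′ y
        pro′ {x} {y} p q e with u ~ x in ex | u ~ y in ey
        ... | true | true = λ _ → no-triangle u∈D (E⊆D p) (E⊆D q) ex ey e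
        ... | true | false = λ ()
        ... | false | true = λ ()
        ... | false | false = λ _ → no-edge p q ex ey e

      rest : Colours B NonZero
      rest = by-components B λ E sub connE closed → case Fin.any? (λ x → E x ≟ true) of λ where
        (no none) → no-vertex λ p → none (_ , p)
        (yes (x , p)) → case E v ≟ true of λ where
          (yes q) → root-piece E sub connE q
          (no q) → piece E sub connE closed (≢true⇒≡false q) p

      col : V → Fin 3
      col x = if v ~ x then zero else colour rest x
      lis : ∀ {x} → x ∈ˢ D → v ~ x ≡ false → col x ≢ zero
      lis {x} p e rewrite e = listed rest (∈∖ {D} {v ~_} p e)
      pro : ∀ {x y} → x ∈ˢ D → y ∈ˢ D → x ~ y ≡ true → col x ≢ col y
      pro {x} {y} p q e with v ~ x in ex | v ~ y in ey
      ... | true | true = λ _ → no-triangle v∈D p q ex ey e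
      ... | true | false = λ h → listed rest (∈∖ {D} {v ~_} q ey) (≡-sym h)
      ... | false | true = listed rest (∈∖ {D} {v ~_} p ex)
      ... | false | false = proper rest (∈∖ {D} {v ~_} p ex) (∈∖ {D} {v ~_} q ey) e

    -- In a component that meets `A`, take the root in `A`: by independence it sees no vertex of
    -- `A`, and what the root does not see avoids colour 0.
    triangle-free-colours : ∀ {S} A → ¬ S has-clique 3 → Indep A →
      Colours {Fin 3} S (λ x c → x ∈ˢ A → c ≢ zero)
    triangle-free-colours {S} A ntri ind = by-components S λ D sub conn _ →
      case Fin.any? (λ x → D x ≟ true ×-dec A x ≟ true) of λ where
        (yes (v , p , q)) → relist (λ _ f r → f (ind q r)) (rooted-colours conn (ntri ∘ clique-⊆ 3 sub) p)
        (no none) → case Fin.any? (λ x → D x ≟ true) of λ where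
          (yes (v , p)) → relist (λ q _ r → ⊥-elim (none (_ , q , r)))
            (rooted-colours conn (ntri ∘ clique-⊆ 3 sub) p)
          (no empty) → no-vertex λ p → empty (_ , p)

    -- N(w) is paw-free, so D is triangle-free or complete multipartite (Olariu).
    neighbourhood-colourable : ∀ {k} → 2 ≤ k → (HasClique G (3 + k) → ⊥) →
      ∀ {D} w → D ⊆ˢ (w ~_) → Conn D → Colourable D (suc k)
    neighbourhood-colourable {k} 2≤k ncl {D} w sub conn with clique? 3 D
    ... | no ntri = record
      { colour = λ x → inject≤ (colour c x) (s≤s 2≤k) ; listed = λ _ → tt
      ; proper = λ p q e → proper c p q e ∘ Fin.inject≤-injective _ _ _ _ }
      where c = triangle-free-colours {D} (λ _ → false) ntri λ ()
    ... | yes (t₁ , t₁∈D , t₂ , t₂∈ , t₃ , t₃∈ , _) = multipartite-colourable k nat λ c →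
      ncl (let f , cl , _ = clique⇒HasClique {λ _ → true} (3 + k) (w , refl , clique-⊆ (2 + k) sub c) in f , cl)
      where
      InTriangle : V → Set
      InTriangle x = ∃ λ a → ∃ λ b → a ∈ˢ D × b ∈ˢ D × x ~ a ≡ true × x ~ b ≡ true × a ~ b ≡ true
      inTriangle? : ∀ x → Dec (InTriangle x)
      inTriangle? x = Fin.any? λ a → Fin.any? λ b →
        D a ≟ true ×-dec D b ≟ true ×-dec x ~ a ≟ true ×-dec x ~ b ≟ true ×-dec a ~ b ≟ true

      -- Otherwise the K₄ on `w`, `x`, `a`, `b` and the vertex `y`, which sees only `w` and `x` of
      -- it, form an HVN.
      paw : ∀ {x a b y} → x ∈ˢ D → a ∈ˢ D → b ∈ˢ D → y ∈ˢ D → x ~ a ≡ true → x ~ b ≡ true →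
        a ~ b ≡ true → x ~ y ≡ true → y ~ a ≡ false → y ~ b ≡ true
      paw {x} {a} {b} {y} p q r s e f g h i = decidable-stable (y ~ b ≟ true) λ j →
        refute (nth w (w ∷ x ∷ a ∷ b ∷ y ∷ []))
          (0 ∼ 1 ∷ 0 ∼ 2 ∷ 0 ∼ 3 ∷ 0 ∼ 4 ∷ 1 ∼ 2 ∷ 1 ∼ 3 ∷ 2 ∼ 3 ∷ 1 ∼ 4 ∷ 4 ≁ 2 ∷ 4 ≁ 3 ∷ [])
          (hvn 0 1 2 3 4)
          (sub p ∷ sub q ∷ sub r ∷ sub s ∷ e ∷ f ∷ g ∷ h ∷ i ∷ ≢true⇒≡false j ∷ [])

      -- Otherwise an edge joins some `y` in a triangle to some `z` in none; by `paw`, `z` sees a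
      -- second vertex of that triangle.
      in-triangle : ∀ {x} → x ∈ˢ D → InTriangle x
      in-triangle {x} p with inTriangle? x
      ... | yes t = t
      ... | no ¬t
        with crossing conn (does ∘ inTriangle?) t₁∈D
               (dec-true (inTriangle? t₁) (t₂ , t₃ , t₂∈D , t₃∈D , t₁~t₂ , t₁~t₃ , t₂~t₃))
               p (dec-false (inTriangle? x) ¬t)
        where
        t₂∈D = proj₁ (∈∩⁻ {D} {t₁ ~_} t₂∈)
        t₁~t₂ = proj₂ (∈∩⁻ {D} {t₁ ~_} t₂∈)
        t₂~t₃ = proj₂ (∈∩⁻ {D ∩ (t₁ ~_)} {t₂ ~_} t₃∈)
        t₃∈D = proj₁ (∈∩⁻ {D} {t₁ ~_} (proj₁ (∈∩⁻ {D ∩ (t₁ ~_)} {t₂ ~_} t₃∈)))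
        t₁~t₃ = proj₂ (∈∩⁻ {D} {t₁ ~_} (proj₁ (∈∩⁻ {D ∩ (t₁ ~_)} {t₂ ~_} t₃∈)))
      ... | y , z , y∈D , z∈D , ty , ¬tz , y~z with does-true (inTriangle? y) ty | does-false (inTriangle? z) ¬tz
      ... | a , b , a∈D , b∈D , y~a , y~b , a~b | ¬t′ with z ~ a in z~a
      ... | true = ⊥-elim (¬t′ (y , a , y∈D , a∈D , ~-sym y~z , z~a , y~a))
      ... | false = ⊥-elim (¬t′ (y , b , y∈D , b∈D , ~-sym y~z ,
        paw y∈D a∈D b∈D z∈D y~a y~b a~b y~z z~a , y~b))

      spread : ∀ {x z c a b} → x ∈ˢ D → z ∈ˢ D → c ∈ˢ D → a ∈ˢ D → b ∈ˢ D →
        x ~ z ≡ true → x ~ c ≡ true → z ~ c ≡ true →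
        a ~ x ≡ true → a ~ b ≡ true → b ~ x ≡ false → b ~ z ≡ false → ⊥
      spread {x} {z} {c} {a} {b} px pz pc pa pb x~z x~c z~c a~x a~b b≁x b≁z with a ~ z in a~z
      ... | true = true≢false (paw pa px pz pb a~x a~z x~z a~b b≁x) b≁z
      ... | false = true≢false
        (paw pc pz px pb (~-sym z~c) (~-sym x~c) (~-sym x~z) (~-sym b~c) b≁z) b≁x
        where
        a~c : a ~ c ≡ true
        a~c = paw px pz pc pa x~z x~c z~c (~-sym a~x) a~z
        b~c : b ~ c ≡ true
        b~c = paw pa px pc pb a~x a~c x~c a~b b≁x

      -- An edge `xz` of a triangle dominates `D`: otherwise some `b` missing both ends has a
      -- neighbour `a` that sees one of them, and repeated use of `paw` in `spread` is
      -- contradictory.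
      dominates : ∀ {x z c} → x ∈ˢ D → z ∈ˢ D → c ∈ˢ D → x ~ z ≡ true → x ~ c ≡ true → z ~ c ≡ true →
        ∀ {y} → y ∈ˢ D → y ~ x ≡ false → y ~ z ≡ false → ⊥
      dominates {x} {z} px pz pc x~z x~c z~c {y} py y≁x y≁z
        with crossing conn (λ u → u ~ x ∨ u ~ z) px
               (trans (cong (x ~ x ∨_) x~z) (Bool.∨-zeroʳ (x ~ x)))
               py (trans (cong (_∨ y ~ z) y≁x) y≁z)
      ... | a , b , pa , pb , qa , qb , a~b with b ~ x in b≁x | b ~ z in b≁z | qb
      ... | false | false | _ with a ~ x in a~x | qa
      ... | true | _ = spread px pz pc pa pb x~z x~c z~c a~x a~b b≁x b≁z
      ... | false | a~z = spread pz px pc pa pb (~-sym x~z) z~c x~c a~z a~b b≁z b≁x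

      -- If `x` saw `z`, the edge `xz` would lie in a triangle and dominate `y`.
      nat : NonAdjTransitive D
      nat {x} {y} {z} px py pz x≁y y≁z = ≢true⇒≡false λ x~z →
        let a , b , pa , pb , x~a , x~b , a~b = in-triangle px in
        case z ~ a ≟ true of λ where
          (yes z~a) → dominates px pz pa x~z x~a z~a py (~-sym x≁y) y≁z
          (no z≁a) → dominates px pz pb x~z x~b
            (paw px pa pb pz x~a x~b a~b x~z (≢true⇒≡false z≁a)) py (~-sym x≁y) y≁z

    -- Labelled T-5-wheels and their symmetries

    record Frame : Set where
      field
        φ : Fin 6 → V
        φ-adj : ∀ i j → φ i ~ φ j ≡ twAdj i j

    reindex : (σ : Fin 6 → Fin 6) → {_ : True (Fin.all? λ i → Fin.all? λ j → twAdj (σ i) (σ j) ≟ twAdj i j)} →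
      Frame → Frame
    reindex σ {t} F = record
      { φ = Frame.φ F ∘ σ ; φ-adj = λ i j → trans (Frame.φ-adj F (σ i) (σ j)) (toWitness t i j) }

    -- The reflection that reverses v₂v₃v₄v₅, and the exchange of the true twins `p` and `q`.
    mirror swap : Frame → Frame
    mirror = reindex (Vec.lookup (# p′ ∷ # 5′ ∷ # 4′ ∷ # 3′ ∷ # 2′ ∷ # q′ ∷ []))
    swap = reindex (Vec.lookup (# q′ ∷ # 2′ ∷ # 3′ ∷ # 4′ ∷ # 5′ ∷ # p′ ∷ []))

    frame-pairs : List (Fin 6 × Fin 6)
    frame-pairs = List.filter (λ (i , j) → i Fin.<? j) (List.cartesianProduct (List.allFin 6) (List.allFin 6))

    frame-fact : Fin 6 × Fin 6 → Fact
    frame-fact (i , j) = toℕ i , toℕ j , twAdj i j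

    frame-facts : List Fact
    frame-facts = List.map frame-fact frame-pairs

    module FrameLemmas (F : Frame) where
      open Frame F public

      p q v₂ v₃ v₄ v₅ : V
      p = φ (# p′)
      v₂ = φ (# 2′)
      v₃ = φ (# 3′)
      v₄ = φ (# 4′)
      v₅ = φ (# 5′)
      q = φ (# q′)

      vertices : List V → ℕ → V
      vertices xs = nth p (p ∷ v₂ ∷ v₃ ∷ v₄ ∷ v₅ ∷ q ∷ xs)

      vertices-φ : ∀ xs i → vertices xs (toℕ i) ≡ φ i
      vertices-φ xs zero = refl
      vertices-φ xs (suc zero) = refl
      vertices-φ xs (suc (suc zero)) = refl
      vertices-φ xs (suc (suc (suc zero))) = refl
      vertices-φ xs (suc (suc (suc (suc zero)))) = refl
      vertices-φ xs (suc (suc (suc (suc (suc zero))))) = refl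

      frame-holds : ∀ xs → All (Holds (vertices xs)) frame-facts
      frame-holds xs = All.map⁺ {f = frame-fact} (All.universal
        (λ (i , j) → trans (cong₂ _~_ (vertices-φ xs i) (vertices-φ xs j)) (φ-adj i j)) frame-pairs)

      -- Certificates then list only facts about additional vertices; those of the wheel are
      -- appended.
      clash : ∀ xs fs r {_ : True (refutes? r (fs ++ frame-facts))} → All (Holds (vertices xs)) fs → ⊥
      clash xs fs r {t} hs = refute (vertices xs) (fs ++ frame-facts) r {t} (All.++⁺ hs (frame-holds xs))

      -- Z is the set of vertices without neighbours in the frame (Z-off), and R* is R of the mirrored frame.
      U I R R* S₁ S₂ Z : VSet
      U x = v₂ ~ x
      I x = p ~ x ∧ q ~ x ∧ not (v₂ ~ x) ∧ not (v₅ ~ x)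
      R x = v₃ ~ x ∧ v₅ ~ x ∧ not (v₂ ~ x)
      R* x = v₄ ~ x ∧ v₂ ~ x ∧ not (v₅ ~ x)
      S₁ x = v₂ ~ x ∧ v₄ ~ x ∧ v₅ ~ x
      S₂ x = v₂ ~ x ∧ v₃ ~ x ∧ v₅ ~ x
      Z x = not (U x) ∧ not (I x) ∧ not (R x)

      -- Membership in the sets of a frame

      record InI (x : V) : Set where
        constructor mkI
        field
          p~ : p ~ x ≡ true
          q~ : q ~ x ≡ true
          v₂≁ : v₂ ~ x ≡ false
          v₅≁ : v₅ ~ x ≡ false

      record InR (x : V) : Set where
        constructor mkR
        field
          v₃~ : v₃ ~ x ≡ true
          v₅~ : v₅ ~ x ≡ true
          v₂≁ : v₂ ~ x ≡ false

      I⁻ : ∀ {x} → x ∈ˢ I → InI x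
      I⁻ {x} e with p ~ x in a | q ~ x in b | v₂ ~ x in c | v₅ ~ x in d | e
      ... | true | true | false | false | _ = mkI a b c d

      R⁻ : ∀ {x} → x ∈ˢ R → InR x
      R⁻ {x} e with v₃ ~ x in a | v₅ ~ x in b | v₂ ~ x in c | e
      ... | true | true | false | _ = mkR a b c

      R*⁻ : ∀ {x} → x ∈ˢ R* → v₄ ~ x ≡ true × v₂ ~ x ≡ true × v₅ ~ x ≡ false
      R*⁻ {x} e with v₄ ~ x | v₂ ~ x | v₅ ~ x | e
      ... | true | true | false | _ = refl , refl , refl

      S₁⁻ : ∀ {x} → x ∈ˢ S₁ → v₂ ~ x ≡ true × v₄ ~ x ≡ true × v₅ ~ x ≡ true
      S₁⁻ {x} e with v₂ ~ x | v₄ ~ x | v₅ ~ x | e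
      ... | true | true | true | _ = refl , refl , refl

      S₂⁻ : ∀ {x} → x ∈ˢ S₂ → v₂ ~ x ≡ true × v₃ ~ x ≡ true × v₅ ~ x ≡ true
      S₂⁻ {x} e with v₂ ~ x | v₃ ~ x | v₅ ~ x | e
      ... | true | true | true | _ = refl , refl , refl

      S₁⁺ : ∀ {x} → v₂ ~ x ≡ true → v₄ ~ x ≡ true → v₅ ~ x ≡ true → x ∈ˢ S₁
      S₁⁺ a b c rewrite a | b | c = refl

      S₂⁺ : ∀ {x} → v₂ ~ x ≡ true → v₃ ~ x ≡ true → v₅ ~ x ≡ true → x ∈ˢ S₂
      S₂⁺ a b c rewrite a | b | c = refl

      I⁺ : ∀ {x} → InI x → x ∈ˢ I
      I⁺ (mkI a b c d) rewrite a | b | c | d = refl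

      R⁺ : ∀ {x} → InR x → x ∈ˢ R
      R⁺ (mkR a b c) rewrite a | b | c = refl

      Z⁻ : ∀ {x} → x ∈ˢ Z → x ∉ˢ U × x ∉ˢ I × x ∉ˢ R
      Z⁻ {x} e with U x | I x | R x | e
      ... | false | false | false | _ = refl , refl , refl

      Z⁺ : ∀ {x} → x ∉ˢ U → x ∉ˢ I → x ∉ˢ R → x ∈ˢ Z
      Z⁺ a b c rewrite a | b | c = refl

      -- The negative information in each constructor follows the order of the tests in `c₀`, so
      -- that `c₀` reduces in each case.
      data Place (x : V) : Set where
        inI : x ∈ˢ I → Place x
        inR : x ∉ˢ I → x ∈ˢ R → Place x
        inU : x ∉ˢ I → x ∉ˢ R → x ∈ˢ U → Place x
        inZ : x ∈ˢ Z → Place x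

      place : ∀ x → Place x
      place x = case I x ≟ true of λ where
        (yes i) → inI i
        (no i) → case R x ≟ true of λ where
          (yes r) → inR (≢true⇒≡false i) r
          (no r) → case U x ≟ true of λ where
            (yes u) → inU (≢true⇒≡false i) (≢true⇒≡false r) u
            (no u) → inZ (Z⁺ (≢true⇒≡false u) (≢true⇒≡false i) (≢true⇒≡false r))

      -- An edge of `I` forms a K₄ with `pq`, of which `v₂` sees only `p` and `q`.
      I-indep : Indep I
      I-indep {x} {y} x∈ y∈ = ≢true⇒≡false λ x~y →
        clash (x ∷ y ∷ [])
          (p′ ∼ x′ ∷ q′ ∼ x′ ∷ 2′ ≁ x′ ∷ p′ ∼ y′ ∷ q′ ∼ y′ ∷ 2′ ≁ y′ ∷ x′ ∼ y′ ∷ [])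
          (hvn p′ q′ x′ y′ 2′)
          (p~ (I⁻ x∈) ∷ q~ (I⁻ x∈) ∷ v₂≁ (I⁻ x∈) ∷ p~ (I⁻ y∈) ∷ q~ (I⁻ y∈) ∷ v₂≁ (I⁻ y∈) ∷ x~y ∷ [])
        where open InI

      -- An edge of `S₁` forms a K₄ with `v₄v₅`, of which `v₂` sees only that edge.
      S₁-indep : Indep S₁
      S₁-indep {x} {y} x∈ y∈ = ≢true⇒≡false λ x~y →
        let x₂ , x₄ , x₅ = S₁⁻ x∈ ; y₂ , y₄ , y₅ = S₁⁻ y∈ in
        clash (x ∷ y ∷ [])
          (2′ ∼ x′ ∷ 4′ ∼ x′ ∷ 5′ ∼ x′ ∷ 2′ ∼ y′ ∷ 4′ ∼ y′ ∷ 5′ ∼ y′ ∷ x′ ∼ y′ ∷ [])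
          (hvn x′ y′ 4′ 5′ 2′)
          (x₂ ∷ x₄ ∷ x₅ ∷ y₂ ∷ y₄ ∷ y₅ ∷ x~y ∷ [])

      S₂-indep : Indep S₂
      S₂-indep {x} {y} x∈ y∈ = ≢true⇒≡false λ x~y →
        let x₂ , x₃ , x₅ = S₂⁻ x∈ ; y₂ , y₃ , y₅ = S₂⁻ y∈ in
        clash (x ∷ y ∷ [])
          (2′ ∼ x′ ∷ 3′ ∼ x′ ∷ 5′ ∼ x′ ∷ 2′ ∼ y′ ∷ 3′ ∼ y′ ∷ 5′ ∼ y′ ∷ x′ ∼ y′ ∷ [])
          (hvn x′ y′ 2′ 3′ 5′)
          (x₂ ∷ x₃ ∷ x₅ ∷ y₂ ∷ y₃ ∷ y₅ ∷ x~y ∷ [])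

      -- How Z attaches to the other vertices

      record Off (x : V) : Set where
        constructor off
        field
          p≁ : p ~ x ≡ false
          q≁ : q ~ x ≡ false
          v₂≁ : v₂ ~ x ≡ false
          v₃≁ : v₃ ~ x ≡ false
          v₄≁ : v₄ ~ x ≡ false
          v₅≁ : v₅ ~ x ≡ false

      -- Being outside `R` excludes common neighbours of `v₃` and `v₅`, and being outside `I` then
      -- excludes those of `p` and `q`. The order `v₅`, `p`, `q`, `v₃`, `v₄` matters, as later
      -- refutations use earlier ones.
      Z-off : ∀ {x} → x ∈ˢ Z → Off x
      Z-off {x} x∈Z = off p≁ q≁ x₂ v₃≁ v₄≁ v₅≁
        where
        x₂ = proj₁ (Z⁻ x∈Z)
        v₅≁ : v₅ ~ x ≡ false
        v₅≁ = ≢true⇒≡false λ x₅ → case v₃ ~ x ≟ true of λ where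
          (yes x₃) → true≢false (R⁺ (mkR x₃ x₅ x₂)) (proj₂ (proj₂ (Z⁻ x∈Z)))
          (no x₃) → clash (x ∷ []) (2′ ≁ x′ ∷ 5′ ∼ x′ ∷ 3′ ≁ x′ ∷ [])
            (split x′ p′ (split x′ q′ (hvn p′ q′ 5′ x′ 2′) (p5 3′ 2′ q′ 5′ x′)) (p5 3′ 2′ p′ 5′ x′))
            (x₂ ∷ x₅ ∷ ≢true⇒≡false x₃ ∷ [])
        not-both : p ~ x ≡ true → q ~ x ≡ true → ⊥
        not-both e f = true≢false (I⁺ (mkI e f x₂ v₅≁)) (proj₁ (proj₂ (Z⁻ x∈Z)))
        p≁ : p ~ x ≡ false
        p≁ = ≢true⇒≡false λ e →
          clash (x ∷ []) (2′ ≁ x′ ∷ 5′ ≁ x′ ∷ q′ ≁ x′ ∷ p′ ∼ x′ ∷ [])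
            (split x′ 3′ (p5 5′ q′ 2′ 3′ x′) (split x′ 4′ (p5 q′ p′ x′ 4′ 3′) (p5 3′ 4′ 5′ p′ x′)))
            (x₂ ∷ v₅≁ ∷ ≢true⇒≡false (not-both e) ∷ e ∷ [])
        q≁ : q ~ x ≡ false
        q≁ = ≢true⇒≡false λ e →
          clash (x ∷ []) (2′ ≁ x′ ∷ 5′ ≁ x′ ∷ p′ ≁ x′ ∷ q′ ∼ x′ ∷ [])
            (split x′ 3′ (p5 5′ p′ 2′ 3′ x′) (split x′ 4′ (p5 p′ q′ x′ 4′ 3′) (p5 3′ 4′ 5′ q′ x′)))
            (x₂ ∷ v₅≁ ∷ p≁ ∷ e ∷ [])
        v₃≁ : v₃ ~ x ≡ false
        v₃≁ = ≢true⇒≡false λ e →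
          clash (x ∷ []) (2′ ≁ x′ ∷ 5′ ≁ x′ ∷ p′ ≁ x′ ∷ 3′ ∼ x′ ∷ [])
            (p5 5′ p′ 2′ 3′ x′) (x₂ ∷ v₅≁ ∷ p≁ ∷ e ∷ [])
        v₄≁ : v₄ ~ x ≡ false
        v₄≁ = ≢true⇒≡false λ e →
          clash (x ∷ []) (2′ ≁ x′ ∷ p′ ≁ x′ ∷ 3′ ≁ x′ ∷ 4′ ∼ x′ ∷ [])
            (p5 p′ 2′ 3′ 4′ x′) (x₂ ∷ p≁ ∷ v₃≁ ∷ e ∷ [])

      v₂∉Z : v₂ ∉ˢ Z
      v₂∉Z = ≢true⇒≡false λ e → true≢false (φ-adj (# p′) (# 2′)) (Off.p≁ (Z-off e))

      -- If `x` misses `v₅`, then v₅-p-v₂-x-z or v₅-q-v₂-x-z is induced, unless `x` sees `p` and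
      -- `q`, which gives an HVN. If it misses `v₃` and `v₄`, then v₄-v₃-v₂-x-z is induced. So `x`
      -- lies in `S₁` or `S₂`.
      U-attach : ∀ {x z} → x ∈ˢ U → z ∈ˢ Z → x ~ z ≡ true → v₅ ~ x ≡ true × (v₃ ~ x ≡ true ⊎ v₄ ~ x ≡ true)
      U-attach {x} {z} x₂ z∈Z x~z = x₅ , third
        where
        open Off (Z-off z∈Z)
        x₅ : v₅ ~ x ≡ true
        x₅ = decidable-stable (v₅ ~ x ≟ true) λ e →
          clash (x ∷ z ∷ [])
            (2′ ∼ x′ ∷ 5′ ≁ x′ ∷ x′ ∼ y′ ∷ p′ ≁ y′ ∷ q′ ≁ y′ ∷ 2′ ≁ y′ ∷ 5′ ≁ y′ ∷ [])
            (split x′ p′ (split x′ q′ (hvn p′ q′ 2′ x′ 5′) (p5 5′ q′ 2′ x′ y′)) (p5 5′ p′ 2′ x′ y′))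
            (x₂ ∷ ≢true⇒≡false e ∷ x~z ∷ p≁ ∷ q≁ ∷ v₂≁ ∷ v₅≁ ∷ [])
        third : v₃ ~ x ≡ true ⊎ v₄ ~ x ≡ true
        third with v₃ ~ x in x₃ | v₄ ~ x in x₄
        ... | true | _ = inj₁ refl
        ... | false | true = inj₂ refl
        ... | false | false = ⊥-elim (clash (x ∷ z ∷ [])
          (2′ ∼ x′ ∷ 3′ ≁ x′ ∷ 4′ ≁ x′ ∷ x′ ∼ y′ ∷ 2′ ≁ y′ ∷ 3′ ≁ y′ ∷ 4′ ≁ y′ ∷ 5′ ∼ x′ ∷ 5′ ≁ y′ ∷ [])
          (p5 4′ 3′ 2′ x′ y′)
          (x₂ ∷ x₃ ∷ x₄ ∷ x~z ∷ v₂≁ ∷ v₃≁ ∷ v₄≁ ∷ x₅ ∷ v₅≁ ∷ []))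

      -- The path p-v₂-v₃-x-z, or the same from `q`, is induced unless `x` sees both twins; then
      -- `p`, `q`, `v₅`, `x`, `v₂` is an HVN.
      R-unattached : ∀ {x z} → InR x → z ∈ˢ Z → x ~ z ≡ true → ⊥
      R-unattached {x} {z} (mkR x₃ x₅ x₂) z∈Z x~z = clash (x ∷ z ∷ [])
        (2′ ≁ x′ ∷ 3′ ∼ x′ ∷ 5′ ∼ x′ ∷ x′ ∼ y′ ∷ p′ ≁ y′ ∷ q′ ≁ y′ ∷ 2′ ≁ y′ ∷ 3′ ≁ y′ ∷ [])
        (split x′ p′ (split x′ q′ (hvn p′ q′ 5′ x′ 2′) (p5 q′ 2′ 3′ x′ y′)) (p5 p′ 2′ 3′ x′ y′))
        (x₂ ∷ x₃ ∷ x₅ ∷ x~z ∷ p≁ ∷ q≁ ∷ v₂≁ ∷ v₃≁ ∷ [])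
        where open Off (Z-off z∈Z)

      -- Otherwise w-y-z extends to an induced path v₂-p-w-y-z for `w` in `I`, and t-v₂-w-y-z for
      -- `w` in `U` and a `t` among `p`, `q`, `v₃` missed by `w`. If `w` in `U` sees all three,
      -- `v₂`, `w`, `p`, `q`, `v₃` is an HVN.
      Z-homogeneous : ∀ {w y z} → w ∉ˢ Z → y ∈ˢ Z → z ∈ˢ Z → w ~ y ≡ true → y ~ z ≡ true → w ~ z ≡ true
      Z-homogeneous {w} {y} {z} w∉Z y∈Z z∈Z w~y y~z = decidable-stable (w ~ z ≟ true) λ w≁z → case place w of λ where
          (inZ e) → true≢false e w∉Z
          (inR _ e) → R-unattached (R⁻ e) y∈Z w~y
          (inI e) → clash (w ∷ y ∷ z ∷ [])
            (p′ ∼ x′ ∷ 2′ ≁ x′ ∷ x′ ∼ y′ ∷ x′ ≁ z′ ∷ y′ ∼ z′ ∷ p′ ≁ y′ ∷ 2′ ≁ y′ ∷ p′ ≁ z′ ∷ 2′ ≁ z′ ∷ [])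
            (p5 2′ p′ x′ y′ z′)
            (InI.p~ (I⁻ e) ∷ InI.v₂≁ (I⁻ e) ∷ w~y ∷ ≢true⇒≡false w≁z ∷ y~z ∷ Y.p≁ ∷ Y.v₂≁ ∷ Z.p≁ ∷ Z.v₂≁ ∷ [])
          (inU _ _ w₂) → clash (w ∷ y ∷ z ∷ [])
            (2′ ∼ x′ ∷ 5′ ∼ x′ ∷ x′ ∼ y′ ∷ x′ ≁ z′ ∷ y′ ∼ z′ ∷ p′ ≁ y′ ∷ q′ ≁ y′ ∷ 2′ ≁ y′ ∷ 3′ ≁ y′ ∷
              p′ ≁ z′ ∷ q′ ≁ z′ ∷ 2′ ≁ z′ ∷ 3′ ≁ z′ ∷ [])
            (split x′ p′ (split x′ q′ (split x′ 3′ (hvn 2′ x′ p′ q′ 3′) (p5 3′ 2′ x′ y′ z′)) (p5 q′ 2′ x′ y′ z′))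
              (p5 p′ 2′ x′ y′ z′))
            (w₂ ∷ proj₁ (U-attach w₂ y∈Z w~y) ∷ w~y ∷ ≢true⇒≡false w≁z ∷ y~z ∷
              Y.p≁ ∷ Y.q≁ ∷ Y.v₂≁ ∷ Y.v₃≁ ∷ Z.p≁ ∷ Z.q≁ ∷ Z.v₂≁ ∷ Z.v₃≁ ∷ [])
        where
        module Y = Off (Z-off y∈Z)
        module Z = Off (Z-off z∈Z)

      S₀ : VSet
      S₀ = S₁ ∩ S₂

      -- `u` misses exactly one of `v₃`, `v₄`. If it misses `v₃` and `y`, then v₃-y-z-u-v₅ or
      -- v₃-v₂-p-y-z is induced, according to whether `y` sees `v₃`; the case of `v₄` is its mirror
      -- image.
      U-I-adjacent : ∀ {y u z} → y ∈ˢ I → u ∈ˢ U → u ∉ˢ S₀ → z ∈ˢ Z → y ~ z ≡ true → u ~ z ≡ true → y ~ u ≡ true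
      U-I-adjacent {y} {u} {z} y∈I u₂ u∉S₀ z∈Z y~z u~z = decidable-stable (y ~ u ≟ true) λ n → go (≢true⇒≡false n)
        where
        open Off (Z-off z∈Z)
        open InI (I⁻ y∈I) using (p~; q~) renaming (v₂≁ to y₂; v₅≁ to y₅)
        u₅ = proj₁ (U-attach u₂ z∈Z u~z)
        ∈S₀ : v₃ ~ u ≡ true → v₄ ~ u ≡ true → u ∈ˢ S₀
        ∈S₀ a b = ∈∩ {S₁} {S₂} (S₁⁺ u₂ b u₅) (S₂⁺ u₂ a u₅)
        go : y ~ u ≡ false → ⊥
        go y≁u with v₃ ~ u ≟ true | v₄ ~ u ≟ true
        ... | yes u₃ | yes u₄ = true≢false (∈S₀ u₃ u₄) u∉S₀
        ... | no u₃ | yes _ = clash (y ∷ u ∷ z ∷ [])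
          (p′ ∼ x′ ∷ 2′ ≁ x′ ∷ 5′ ≁ x′ ∷ 3′ ≁ y′ ∷ 5′ ∼ y′ ∷ x′ ≁ y′ ∷ x′ ∼ z′ ∷ y′ ∼ z′ ∷
            p′ ≁ z′ ∷ 2′ ≁ z′ ∷ 3′ ≁ z′ ∷ 5′ ≁ z′ ∷ [])
          (split x′ 3′ (p5 3′ x′ z′ y′ 5′) (p5 3′ 2′ p′ x′ z′))
          (p~ ∷ y₂ ∷ y₅ ∷ ≢true⇒≡false u₃ ∷ u₅ ∷ y≁u ∷ y~z ∷ u~z ∷ p≁ ∷ v₂≁ ∷ v₃≁ ∷ v₅≁ ∷ [])
        ... | yes _ | no u₄ = clash (y ∷ u ∷ z ∷ [])
          (p′ ∼ x′ ∷ 2′ ≁ x′ ∷ 5′ ≁ x′ ∷ 4′ ≁ y′ ∷ 2′ ∼ y′ ∷ x′ ≁ y′ ∷ x′ ∼ z′ ∷ y′ ∼ z′ ∷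
            p′ ≁ z′ ∷ 2′ ≁ z′ ∷ 4′ ≁ z′ ∷ 5′ ≁ z′ ∷ [])
          (split x′ 4′ (p5 4′ x′ z′ y′ 2′) (p5 4′ 5′ p′ x′ z′))
          (p~ ∷ y₂ ∷ y₅ ∷ ≢true⇒≡false u₄ ∷ u₂ ∷ y≁u ∷ y~z ∷ u~z ∷ p≁ ∷ v₂≁ ∷ v₄≁ ∷ v₅≁ ∷ [])
        ... | no u₃ | no u₄ = [ u₃ , u₄ ]′ (proj₂ (U-attach u₂ z∈Z u~z))

      Z-complete : ∀ {D w x y} → D ⊆ˢ Z → Conn D → w ∉ˢ Z → x ∈ˢ D → y ∈ˢ D → w ~ x ≡ true → w ~ y ≡ true
      Z-complete {D} {w} {x} {y} sub conn w∉Z x∈D y∈D w~x = decidable-stable (w ~ y ≟ true) λ n →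
        let a , b , a∈D , b∈D , w~a , w≁b , a~b = crossing conn (w ~_) x∈D w~x y∈D (≢true⇒≡false n) in
        true≢false (Z-homogeneous w∉Z (sub a∈D) (sub b∈D) w~a a~b) w≁b

      -- A walk from a component `D` to `v₂` leaves `D` at some `w`, which is outside `Z` because
      -- `D` is closed and then complete to `D` by `Z-complete`.
      Z-colours : Connected G → ∀ {m} {L : V → Fin (suc m) → Set} →
        (∀ D → D ⊆ˢ Z → Conn D → ∀ {d} → d ∈ˢ D → ∀ w → w ∉ˢ Z → D ⊆ˢ (w ~_) → Colours D L) →
        Colours Z L
      Z-colours connG {L = L} f = by-components Z λ D sub conn closed → case Fin.any? (λ x → D x ≟ true) of λ where
          (no empty) → no-vertex λ e → empty (_ , e)
          (yes (d , d∈D)) → attached D sub conn closed d∈D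
        where
        attached : ∀ D → D ⊆ˢ Z → Conn D → Closed D Z → ∀ {d} → d ∈ˢ D → Colours D L
        attached D sub conn closed {d} d∈D =
          let x , w , x∈D , w∉D , x~w = walk-crossing D (connG d v₂) d∈D
                (≢true⇒≡false λ e → true≢false (sub e) v₂∉Z)
              w∉Z = ≢true⇒≡false λ e → true≢false x~w (closed x∈D e w∉D)
          in f D sub conn d∈D w w∉Z λ y∈D → Z-complete sub conn w∉Z x∈D y∈D (~-sym x~w)

      -- Colourings when R is independent

      U-colourable : ∀ {k} → 2 ≤ k → (HasClique G (3 + k) → ⊥) → Colourable U (suc k)
      U-colourable 2≤k ncl = by-components U λ D sub conn _ → neighbourhood-colourable 2≤k ncl v₂ sub conn

      indep-∩ : ∀ S A → Indep A → Indep (S ∩ A)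
      indep-∩ S A ind a b = ind (proj₂ (∈∩⁻ {S} {A} a)) (proj₂ (∈∩⁻ {S} {A} b))

      -- By `U-attach`, deleting `S₁` and `S₂` removes every edge between `U` and `Z`, so both reuse
      -- the same `suc k` colours beside the four classes.
      colourable-large : Connected G → ∀ {k} → 2 ≤ k → (HasClique G (3 + k) → ⊥) → Indep R → Colourable full (5 + k)
      colourable-large connG {k} 2≤k ncl R-indep =
        add-class {full} I (indep-∩ full I I-indep) (add-class {full ∖ I} R (indep-∩ (full ∖ I) R R-indep)
          (add-class {full ∖ I ∖ R} S₁ (indep-∩ (full ∖ I ∖ R) S₁ S₁-indep)
          (add-class {full ∖ I ∖ R ∖ S₁} S₂ (indep-∩ (full ∖ I ∖ R ∖ S₁) S₂ S₂-indep) (glue {S = X} U closed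
            (colours-⊆ {S = X ∩ U} {T = U} (λ e → proj₂ (∈∩⁻ {X} {U} e)) (U-colourable 2≤k ncl))
            (colours-⊆ {S = X ∖ U} {T = Z} (λ e → let a , b = ∈∖⁻ {X} {U} e in ∈Z a b) Z-colourable)))))
        where
        X : VSet
        X = full ∖ I ∖ R ∖ S₁ ∖ S₂
        ∉S₂ : ∀ {x} → x ∈ˢ X → x ∉ˢ S₂
        ∉S₂ e = proj₂ (∈∖⁻ {full ∖ I ∖ R ∖ S₁} {S₂} e)
        ∉S₁ : ∀ {x} → x ∈ˢ X → x ∉ˢ S₁
        ∉S₁ e = proj₂ (∈∖⁻ {full ∖ I ∖ R} {S₁} (proj₁ (∈∖⁻ {full ∖ I ∖ R ∖ S₁} {S₂} e)))
        ∈Z : ∀ {x} → x ∈ˢ X → x ∉ˢ U → x ∈ˢ Z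
        ∈Z e x∉U =
          let f = proj₁ (∈∖⁻ {full ∖ I ∖ R} {S₁} (proj₁ (∈∖⁻ {full ∖ I ∖ R ∖ S₁} {S₂} e)))
              g , x∉R = ∈∖⁻ {full ∖ I} {R} f
          in Z⁺ x∉U (proj₂ (∈∖⁻ {full} {I} g)) x∉R
        Z-colourable : Colourable Z (suc k)
        Z-colourable = Z-colours connG λ D sub conn _ w _ D⊆Nw → neighbourhood-colourable 2≤k ncl w D⊆Nw conn
        closed : Closed (X ∩ U) X
        closed {x} {y} e y∈X f = ≢true⇒≡false λ x~y →
          let x∈X , x₂ = ∈∩⁻ {X} {U} e
              x₅ , x₃₄ = U-attach x₂ (∈Z y∈X (∉∩ {X} {U} y∈X f)) x~y
          in [ (λ x₃ → true≢false (S₂⁺ x₂ x₃ x₅) (∉S₂ x∈X)) , (λ x₄ → true≢false (S₁⁺ x₂ x₄ x₅) (∉S₁ x∈X)) ]′ x₃₄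

      -- U takes colours 0, 1, 2 with S₀ avoiding 0, while I takes 3 and R takes 4.  A component of Z takes
      -- its colours from {3,4,5} or {0,4,5}, or only 5, depending on its neighbours in I and U.
      module SmallClique (connG : Connected G) (R-indep : Indep R)
        (nbhd-triangle-free : ∀ {D} w → D ⊆ˢ (w ~_) → ¬ D has-clique 3)
        (cU : Colours {Fin 3} U (λ x c → x ∈ˢ S₀ → c ≢ zero)) where

        low mid high : Fin 3 → Fin 6
        low = Vec.lookup (# 0 ∷ # 1 ∷ # 2 ∷ [])
        mid = Vec.lookup (# 0 ∷ # 4 ∷ # 5 ∷ [])
        high = Vec.lookup (# 3 ∷ # 4 ∷ # 5 ∷ [])

        injective? : ∀ (f : Fin 3 → Fin 6) → Dec (∀ i j → f i ≡ f j → i ≡ j)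
        injective? f = Fin.all? λ i → Fin.all? λ j → f i Fin.≟ f j →-dec i Fin.≟ j

        misses? : ∀ (f : Fin 3 → Fin 6) c → Dec (∀ i → c ≢ f i)
        misses? f c = Fin.all? λ i → ¬? (c Fin.≟ f i)

        low≢high : ∀ i j → low i ≢ high j
        low≢high = from-yes (Fin.all? λ i → misses? high (low i))

        low≢mid : ∀ i j → i ≢ zero → low i ≢ mid j
        low≢mid = from-yes (Fin.all? λ i → Fin.all? λ j → ¬? (i Fin.≟ zero) →-dec ¬? (low i Fin.≟ mid j))

        3≢low : ∀ i → # 3 ≢ low i
        3≢low = from-yes (misses? low (# 3))

        4≢low : ∀ i → # 4 ≢ low i
        4≢low = from-yes (misses? low (# 4))

        c₀ : V → Fin 6
        c₀ x = if I x then # 3 else if R x then # 4 else low (colour cU x)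

        c₀-I : ∀ {x} → x ∈ˢ I → c₀ x ≡ # 3
        c₀-I e rewrite e = refl
        c₀-R : ∀ {x} → x ∉ˢ I → x ∈ˢ R → c₀ x ≡ # 4
        c₀-R e f rewrite e | f = refl
        c₀-U : ∀ {x} → x ∉ˢ I → x ∉ˢ R → c₀ x ≡ low (colour cU x)
        c₀-U e f rewrite e | f = refl

        c₀-proper : ∀ {x y} → x ∉ˢ Z → y ∉ˢ Z → x ~ y ≡ true → c₀ x ≢ c₀ y
        c₀-proper {x} {y} x∉Z y∉Z e h with place x | place y
        ... | inZ a | _ = true≢false a x∉Z
        ... | _ | inZ b = true≢false b y∉Z
        ... | inI a | inI b = true≢false e (I-indep a b)
        ... | inI a | inR b b′ = case trans (≡-sym (c₀-I a)) (trans h (c₀-R b b′)) of λ ()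
        ... | inI a | inU b b′ _ = 3≢low (colour cU y) (trans (≡-sym (c₀-I a)) (trans h (c₀-U b b′)))
        ... | inR a a′ | inI b = case trans (≡-sym (c₀-R a a′)) (trans h (c₀-I b)) of λ ()
        ... | inR _ a | inR _ b = true≢false e (R-indep a b)
        ... | inR a a′ | inU b b′ _ = 4≢low (colour cU y) (trans (≡-sym (c₀-R a a′)) (trans h (c₀-U b b′)))
        ... | inU a a′ _ | inI b = 3≢low (colour cU x) (≡-sym (trans (≡-sym (c₀-U a a′)) (trans h (c₀-I b))))
        ... | inU a a′ _ | inR b b′ = 4≢low (colour cU x) (≡-sym (trans (≡-sym (c₀-U a a′)) (trans h (c₀-R b b′))))
        ... | inU a a′ a″ | inU b b′ b″ = proper cU a″ b″ e
          (from-yes (injective? low) _ _ (trans (≡-sym (c₀-U a a′)) (trans h (c₀-U b b′))))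

        Free-for : V → Fin 6 → Set
        Free-for z c = ∀ {w} → w ∉ˢ Z → w ~ z ≡ true → c₀ w ≢ c

        module Component (D : VSet) (sub : D ⊆ˢ Z) (conn : Conn D) {d : V} (d∈D : d ∈ˢ D)
                         (ntri : ¬ D has-clique 3) where

          cD : Colours {Fin 3} D (λ _ c → false ≡ true → c ≢ zero)
          cD = triangle-free-colours (λ _ → false) ntri λ ()

          -- Vertices outside `Z` are complete or anticomplete to `D`, so the representative `d`
          -- decides adjacency.
          sees-d : ∀ {w z} → w ∉ˢ Z → z ∈ˢ D → w ~ z ≡ true → w ~ d ≡ true
          sees-d w∉Z z∈D = Z-complete sub conn w∉Z z∈D d∈D

          -- Only `U` attaches to `D`, and it uses colours 0, 1, 2.
          avoiding-I : ¬ (∃ λ y → y ∈ˢ I × y ~ d ≡ true) → Colours D Free-for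
          avoiding-I none = record
            { colour = high ∘ colour cD ; listed = lis
            ; proper = λ a b e h → proper cD a b e (from-yes (injective? high) _ _ h) }
            where
            lis : ∀ {z} → z ∈ˢ D → Free-for z (high (colour cD z))
            lis {z} z∈D {w} w∉Z w~z h with place w
            ... | inZ a = true≢false a w∉Z
            ... | inR _ a = R-unattached (R⁻ a) (sub z∈D) w~z
            ... | inI a = none (w , a , sees-d w∉Z z∈D w~z)
            ... | inU a b _ = low≢high (colour cU w) (colour cD z) (trans (≡-sym (c₀-U a b)) h)

          -- The neighbours of `D` lie in `I`, coloured 3, and in `S₀`, coloured 1 or 2.
          avoiding-U : ¬ (∃ λ u → u ∈ˢ U × u ∉ˢ S₀ × u ~ d ≡ true) → Colours D Free-for
          avoiding-U none = record
            { colour = mid ∘ colour cD ; listed = lis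
            ; proper = λ a b e h → proper cD a b e (from-yes (injective? mid) _ _ h) }
            where
            lis : ∀ {z} → z ∈ˢ D → Free-for z (mid (colour cD z))
            lis {z} z∈D {w} w∉Z w~z h with place w
            ... | inZ a = true≢false a w∉Z
            ... | inR _ a = R-unattached (R⁻ a) (sub z∈D) w~z
            ... | inI a = from-yes (misses? mid (# 3)) (colour cD z) (trans (≡-sym (c₀-I a)) h)
            ... | inU a b u with S₀ w ≟ true
            ... | yes s = low≢mid (colour cU w) (colour cD z) (listed cU u s) (trans (≡-sym (c₀-U a b)) h)
            ... | no s = none (w , u , ≢true⇒≡false s , sees-d w∉Z z∈D w~z)

          -- `y` and `u` are adjacent and complete to `D`, so an edge in `D` would complete a K₄.
          -- Hence the single colour 5, absent from `c₀`, is enough.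
          single : ∀ {y u} → y ∈ˢ I → y ~ d ≡ true → u ∈ˢ U → u ∉ˢ S₀ → u ~ d ≡ true → Colours D Free-for
          single {y} {u} y∈I y~d u∈U u∉S₀ u~d = record
            { colour = λ _ → # 5 ; listed = λ _ {w} _ _ → not-5 w ; proper = λ a b e _ → no-edge a b e }
            where
            not-5 : ∀ w → c₀ w ≢ # 5
            not-5 w h with I w
            not-5 w () | true
            ... | false with R w
            not-5 w () | false | true
            ... | false = from-yes (misses? low (# 5)) (colour cU w) (≡-sym h)
            y∉Z : y ∉ˢ Z
            y∉Z = ≢true⇒≡false λ e → true≢false y∈I (proj₁ (proj₂ (Z⁻ e)))
            u∉Z : u ∉ˢ Z
            u∉Z = ≢true⇒≡false λ e → true≢false u∈U (proj₁ (Z⁻ e))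
            no-edge : ∀ {a b} → a ∈ˢ D → b ∈ˢ D → a ~ b ≡ true → ⊥
            no-edge {a} {b} a∈D b∈D a~b = nbhd-triangle-free {y ~_} y (λ e → e)
              (u , y~u , a , ∈∩ {y ~_} {u ~_} (all y∉Z a∈D y~d) u~a ,
               b , ∈∩ {(y ~_) ∩ (u ~_)} {a ~_} (∈∩ {y ~_} {u ~_} (all y∉Z b∈D y~d) (all u∉Z b∈D u~d)) a~b , tt)
              where
              all : ∀ {w z} → w ∉ˢ Z → z ∈ˢ D → w ~ d ≡ true → w ~ z ≡ true
              all w∉Z z∈D = Z-complete sub conn w∉Z d∈D z∈D
              u~a = all u∉Z a∈D u~d
              y~u = U-I-adjacent y∈I u∈U u∉S₀ (sub d∈D) y~d u~d

          colours : Colours D Free-for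
          colours = case Fin.any? (λ y → I y ≟ true ×-dec y ~ d ≟ true) of λ where
            (no none) → avoiding-I none
            (yes (y , y∈I , y~d)) →
              case Fin.any? (λ u → U u ≟ true ×-dec S₀ u ≟ false ×-dec u ~ d ≟ true) of λ where
                (no none) → avoiding-U none
                (yes (u , u∈U , u∉S₀ , u~d)) → single y∈I y~d u∈U u∉S₀ u~d

        colourable : Colourable full 6
        colourable = extend c₀ c₀-proper (Z-colours connG λ D sub conn d∈D w _ D⊆Nw →
          Component.colours D sub conn d∈D (nbhd-triangle-free w D⊆Nw))

      colourable-small : Connected G → (HasClique G 4 → ⊥) → Indep R → Colourable full 6
      colourable-small connG ncl R-indep = SmallClique.colourable connG R-indep nbhd-triangle-free
        -- `S₀` is independent as a part of `S₁`, so it can avoid colour 0.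
        (triangle-free-colours S₀ (nbhd-triangle-free v₂ (λ e → e))
          λ a b → S₁-indep (proj₁ (∈∩⁻ {S₁} {S₂} a)) (proj₁ (∈∩⁻ {S₁} {S₂} b)))
        where
        nbhd-triangle-free : ∀ {D} w → D ⊆ˢ (w ~_) → ¬ D has-clique 3
        nbhd-triangle-free w sub c = ncl
          (let f , cl , _ = clique⇒HasClique {full} 4 (w , refl , clique-⊆ 3 sub c) in f , cl)

      -- Non-adjacent pairs between R and R*

      non-adjacent-pair : ∀ {r s} → r ∈ˢ R → s ∈ˢ R* → r ~ s ≡ false → p ~ r ≡ true → q ~ s ≡ true
      non-adjacent-pair {r} {s} r∈ s∈ r≁s p~r =
        let mkR r₃ r₅ r₂ = R⁻ r∈ ; s₄ , s₂ , s₅ = R*⁻ s∈ in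
        -- If `q` misses `s`, then r-v₅-q-v₂-s is induced, or `r` sees `q` too and `p`, `q`, `v₅`,
        -- `r`, `v₂` is an HVN.
        decidable-stable (q ~ s ≟ true) λ n → clash (r ∷ s ∷ [])
          (2′ ≁ x′ ∷ 5′ ∼ x′ ∷ 2′ ∼ y′ ∷ 5′ ≁ y′ ∷ x′ ≁ y′ ∷ p′ ∼ x′ ∷ q′ ≁ y′ ∷ [])
          (split x′ q′ (hvn p′ q′ 5′ x′ 2′) (p5 x′ 5′ q′ 2′ y′))
          (r₂ ∷ r₅ ∷ s₂ ∷ s₅ ∷ r≁s ∷ p~r ∷ ≢true⇒≡false n ∷ [])

      -- If `r` misses both twins, then r-v₅-t-v₂-s is induced for any twin t missed by `s`; if `s`
      -- sees both, `p`, `q`, `v₂`, `s`, `v₅` is an HVN.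
      non-adjacent-p⊎q : ∀ {r s} → r ∈ˢ R → s ∈ˢ R* → r ~ s ≡ false → p ~ r ≡ true ⊎ q ~ r ≡ true
      non-adjacent-p⊎q {r} {s} r∈ s∈ r≁s with p ~ r in r₀ | q ~ r in r₁
      ... | true | _ = inj₁ refl
      ... | false | true = inj₂ refl
      ... | false | false = let mkR r₃ r₅ r₂ = R⁻ r∈ ; s₄ , s₂ , s₅ = R*⁻ s∈ in
        ⊥-elim (clash (r ∷ s ∷ [])
          (2′ ≁ x′ ∷ 5′ ∼ x′ ∷ 2′ ∼ y′ ∷ 5′ ≁ y′ ∷ x′ ≁ y′ ∷ p′ ≁ x′ ∷ q′ ≁ x′ ∷ [])
          (split y′ p′ (split y′ q′ (hvn p′ q′ 2′ y′ 5′) (p5 x′ 5′ q′ 2′ y′)) (p5 x′ 5′ p′ 2′ y′))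
          (r₂ ∷ r₅ ∷ s₂ ∷ s₅ ∷ r≁s ∷ r₀ ∷ r₁ ∷ []))

      complete-edges : ∀ {r r₁ s s₁} → r ∈ˢ R → r₁ ∈ˢ R → r ~ r₁ ≡ true → s ∈ˢ R* → s₁ ∈ˢ R* → s ~ s₁ ≡ true →
        r ~ s ≡ true → r ~ s₁ ≡ true → r₁ ~ s ≡ true → r₁ ~ s₁ ≡ true → ⊥
      complete-edges {r} {r₁} {s} {s₁} a b e c d f g h i j =
        clash (r ∷ r₁ ∷ s ∷ s₁ ∷ [])
          (5′ ∼ x′ ∷ 5′ ∼ y′ ∷ x′ ∼ y′ ∷ 5′ ≁ z′ ∷ 5′ ≁ w′ ∷ z′ ∼ w′ ∷ x′ ∼ z′ ∷ x′ ∼ w′ ∷ y′ ∼ z′ ∷ y′ ∼ w′ ∷ [])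
          (hvn x′ y′ z′ w′ 5′)
          (v₅~ (R⁻ a) ∷ v₅~ (R⁻ b) ∷ e ∷ proj₂ (proj₂ (R*⁻ c)) ∷ proj₂ (proj₂ (R*⁻ d)) ∷ f ∷ g ∷ h ∷ i ∷ j ∷ [])
        where open InR

      module NonAdjacentPair {r s} (r∈R : r ∈ˢ R) (s∈R* : s ∈ˢ R*) (r≁s : r ~ s ≡ false)
                             (p~r : p ~ r ≡ true) (q~s : q ~ s ≡ true) where
        open InR (R⁻ r∈R) renaming (v₃~ to r₃; v₅~ to r₅; v₂≁ to r₂)
        s₄ = proj₁ (R*⁻ s∈R*)
        s₂ = proj₁ (proj₂ (R*⁻ s∈R*))
        s₅ = proj₂ (proj₂ (R*⁻ s∈R*))

        q≁r : q ~ r ≡ false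
        q≁r = ≢true⇒≡false λ e → clash (r ∷ [])
          (p′ ∼ x′ ∷ q′ ∼ x′ ∷ 2′ ≁ x′ ∷ 5′ ∼ x′ ∷ []) (hvn p′ q′ 5′ x′ 2′) (p~r ∷ e ∷ r₂ ∷ r₅ ∷ [])

        p≁s : p ~ s ≡ false
        p≁s = ≢true⇒≡false λ e → clash (s ∷ [])
          (p′ ∼ x′ ∷ q′ ∼ x′ ∷ 5′ ≁ x′ ∷ 2′ ∼ x′ ∷ []) (hvn p′ q′ 2′ x′ 5′) (e ∷ q~s ∷ s₅ ∷ s₂ ∷ [])

        r₄ : v₄ ~ r ≡ true
        r₄ = decidable-stable (v₄ ~ r ≟ true) λ n → clash (r ∷ [])
          (p′ ∼ x′ ∷ q′ ≁ x′ ∷ 3′ ∼ x′ ∷ 4′ ≁ x′ ∷ []) (p5 q′ p′ x′ 3′ 4′)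
          (p~r ∷ q≁r ∷ r₃ ∷ ≢true⇒≡false n ∷ [])

        s₃ : v₃ ~ s ≡ true
        s₃ = decidable-stable (v₃ ~ s ≟ true) λ n → clash (s ∷ [])
          (q′ ∼ x′ ∷ p′ ≁ x′ ∷ 4′ ∼ x′ ∷ 3′ ≁ x′ ∷ []) (p5 p′ q′ x′ 4′ 3′)
          (q~s ∷ p≁s ∷ s₄ ∷ ≢true⇒≡false n ∷ [])

        -- The adjacency of `r` and `s` to the wheel is now fully determined. They occupy `x′` and
        -- `y′`, so further vertices start at `z′`.
        pair-facts : List Fact
        pair-facts = p′ ∼ x′ ∷ q′ ≁ x′ ∷ 2′ ≁ x′ ∷ 3′ ∼ x′ ∷ 4′ ∼ x′ ∷ 5′ ∼ x′ ∷
          p′ ≁ y′ ∷ q′ ∼ y′ ∷ 2′ ∼ y′ ∷ 3′ ∼ y′ ∷ 4′ ∼ y′ ∷ 5′ ≁ y′ ∷ x′ ≁ y′ ∷ []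

        pair-holds : ∀ xs → All (Holds (vertices (r ∷ s ∷ xs))) pair-facts
        pair-holds xs = p~r ∷ q≁r ∷ r₂ ∷ r₃ ∷ r₄ ∷ r₅ ∷ p≁s ∷ q~s ∷ s₂ ∷ s₃ ∷ s₄ ∷ s₅ ∷ r≁s ∷ []

        -- This cuts `Z` off from `v₂`, so connectivity will force `Z` to be empty.
        Z-unattached : ∀ {x z} → x ∉ˢ Z → z ∈ˢ Z → x ~ z ≡ true → ⊥
        Z-unattached {x} {z} x∉Z z∈Z x~z = case place x of λ where
            (inZ e) → true≢false e x∉Z
            (inR _ e) → R-unattached (R⁻ e) z∈Z x~z
            (inI e) → clash (r ∷ s ∷ x ∷ z ∷ [])
              (p′ ∼ z′ ∷ q′ ∼ z′ ∷ 2′ ≁ z′ ∷ z′ ∼ w′ ∷ p′ ≁ w′ ∷ 2′ ≁ w′ ∷ 3′ ≁ w′ ∷ 4′ ≁ w′ ∷ 5′ ≁ w′ ∷ pair-facts)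
              (split z′ 3′ (split z′ 4′ (split z′ x′ (hvn x′ z′ 3′ 4′ p′) (p5 2′ q′ z′ 4′ x′))
                (split z′ 5′ (hvn p′ q′ 5′ z′ 2′) (p5 4′ 5′ p′ z′ w′))) (p5 3′ 2′ p′ z′ w′))
              (InI.p~ (I⁻ e) ∷ InI.q~ (I⁻ e) ∷ InI.v₂≁ (I⁻ e) ∷ x~z ∷ p≁ ∷ v₂≁ ∷ v₃≁ ∷ v₄≁ ∷ v₅≁ ∷ pair-holds _)
            (inU _ _ x₂) → clash (r ∷ s ∷ x ∷ z ∷ [])
              (2′ ∼ z′ ∷ 5′ ∼ z′ ∷ z′ ∼ w′ ∷ x′ ≁ w′ ∷ y′ ≁ w′ ∷
                p′ ≁ w′ ∷ q′ ≁ w′ ∷ 2′ ≁ w′ ∷ 3′ ≁ w′ ∷ 4′ ≁ w′ ∷ 5′ ≁ w′ ∷ pair-facts)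
              (split z′ p′
                (split z′ q′
                  (split z′ x′ (hvn p′ z′ q′ 2′ x′) (hvn p′ 5′ q′ z′ x′))
                  (split z′ 3′ (split z′ y′ (hvn 2′ y′ 3′ z′ q′) (p5 q′ y′ 3′ z′ w′))
                    (split z′ 4′ (p5 q′ p′ z′ 4′ 3′) (p5 3′ 4′ 5′ z′ w′))))
                (split z′ q′
                  (split z′ 3′ (split z′ y′ (hvn q′ 2′ y′ z′ p′) (p5 p′ 5′ z′ 3′ y′))
                    (split z′ 4′ (p5 p′ q′ z′ 4′ 3′) (p5 3′ 4′ 5′ z′ w′)))
                  (split z′ 3′ (split z′ x′ (p5 q′ p′ x′ z′ w′) (p5 p′ x′ 3′ z′ w′))
                    (split z′ x′ (p5 q′ p′ x′ z′ w′) (p5 3′ x′ 5′ z′ w′)))))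
              (x₂ ∷ proj₁ (U-attach x₂ z∈Z x~z) ∷ x~z ∷
                -- `r` misses `z` as a member of `R`, and `s` does because `U-attach` would make it
                -- see `v₅`.
                ≢true⇒≡false (R-unattached (R⁻ r∈R) z∈Z) ∷
                ≢true⇒≡false (λ s~z → true≢false (proj₁ (U-attach s₂ z∈Z s~z)) s₅) ∷
                p≁ ∷ q≁ ∷ v₂≁ ∷ v₃≁ ∷ v₄≁ ∷ v₅≁ ∷ pair-holds _)
          where open Off (Z-off z∈Z)

        R-near-indep : Indep (R ∩ (p ~_))
        R-near-indep {x} {y} a b = ≢true⇒≡false λ x~y →
          let a₁ , a₂ = ∈∩⁻ {R} {p ~_} a ; b₁ , b₂ = ∈∩⁻ {R} {p ~_} b in
          clash (x ∷ y ∷ [])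
            (3′ ∼ x′ ∷ 5′ ∼ x′ ∷ p′ ∼ x′ ∷ 3′ ∼ y′ ∷ 5′ ∼ y′ ∷ p′ ∼ y′ ∷ x′ ∼ y′ ∷ [])
            (hvn x′ y′ p′ 5′ 3′)
            (InR.v₃~ (R⁻ a₁) ∷ InR.v₅~ (R⁻ a₁) ∷ a₂ ∷ InR.v₃~ (R⁻ b₁) ∷ InR.v₅~ (R⁻ b₁) ∷ b₂ ∷ x~y ∷ [])

        -- If `x` misses `r`, then v₂-s-x-v₅-r or p-v₅-x-v₃-s is induced. If `x` sees `r` and `y`
        -- does not, v₂-p-r-x-y is. If both see `r`, then `p` sees only `v₅` and `r` of the K₄ on
        -- `v₅`, `r`, `x`, `y`.
        R-far-indep : ∀ {x y} → x ∈ˢ R → p ~ x ≡ false → y ∈ˢ R → p ~ y ≡ false → x ~ y ≡ false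
        R-far-indep {x} {y} a p≁x b p≁y = ≢true⇒≡false λ x~y →
          let mkR x₃ x₅ x₂ = R⁻ a ; mkR y₃ y₅ y₂ = R⁻ b in
          clash (r ∷ s ∷ x ∷ y ∷ [])
            (3′ ∼ z′ ∷ 5′ ∼ z′ ∷ 2′ ≁ z′ ∷ p′ ≁ z′ ∷ 3′ ∼ w′ ∷ 5′ ∼ w′ ∷ 2′ ≁ w′ ∷ p′ ≁ w′ ∷ z′ ∼ w′ ∷ pair-facts)
            (split z′ x′ (split w′ x′ (hvn 5′ x′ z′ w′ p′) (p5 2′ p′ x′ z′ w′))
              (split z′ y′ (p5 2′ y′ z′ 5′ x′) (p5 p′ 5′ z′ 3′ y′)))
            (x₃ ∷ x₅ ∷ x₂ ∷ p≁x ∷ y₃ ∷ y₅ ∷ y₂ ∷ p≁y ∷ x~y ∷ pair-holds _)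

        colourable : Connected G → ∀ {k} → 2 ≤ k → (HasClique G (3 + k) → ⊥) → Colourable full (4 + k)
        colourable connG {k} 2≤k ncl =
          add-class {full} I (indep-∩ full I I-indep) (add-class {full ∖ I} Rₚ (indep-∩ (full ∖ I) Rₚ R-near-indep)
            (add-class {X} R far (colours-⊆ {S = X ∖ R} {T = U} ∈U (U-colourable 2≤k ncl))))
          where
          Rₚ X : VSet
          Rₚ = R ∩ (p ~_)
          X = full ∖ I ∖ Rₚ
          far : Indep (X ∩ R)
          far {x} {y} a b = R-far-indep (proj₂ (∈∩⁻ {X} {R} a)) (p≁ a) (proj₂ (∈∩⁻ {X} {R} b)) (p≁ b)
            where
            p≁ : ∀ {x} → x ∈ˢ X ∩ R → p ~ x ≡ false
            p≁ e = let f , g = ∈∩⁻ {X} {R} e in ∉∩ {R} {p ~_} g (proj₂ (∈∖⁻ {full ∖ I} {Rₚ} f))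
          Z-empty : ∀ {z} → z ∈ˢ Z → ⊥
          Z-empty {z} z∈Z = let x , w , x∈Z , w∉Z , x~w = walk-crossing Z (connG z v₂) z∈Z v₂∉Z
            in Z-unattached w∉Z x∈Z (~-sym x~w)
          ∈U : X ∖ R ⊆ˢ U
          ∈U {x} e with place x
          ... | inU _ _ a = a
          ... | inZ a = ⊥-elim (Z-empty a)
          ... | inR _ a = ⊥-elim (true≢false a (proj₂ (∈∖⁻ {X} {R} e)))
          ... | inI a = ⊥-elim (true≢false a
            (proj₂ (∈∖⁻ {full} {I} (proj₁ (∈∖⁻ {full ∖ I} {Rₚ} (proj₁ (∈∖⁻ {X} {R} e)))))))

    -- Choice of the frame

    by-frame : ∀ {A : Set} → (∀ F → Indep (FrameLemmas.R F) → A) →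
      (∀ F {r s} → let open FrameLemmas F in
        r ∈ˢ R → s ∈ˢ R* → r ~ s ≡ false → p ~ r ≡ true → q ~ s ≡ true → A) →
      Frame → A
    by-frame {A} independent non-adjacent F = case edge? R of λ where
        (no none) → independent F (edgeless none)
        (yes (r , r₁ , r∈ , r₁∈ , r~r₁)) → case edge? R* of λ where
          -- The set `R` of the mirrored frame reduces to `R*`.
          (no none) → independent (mirror F) (edgeless none)
          (yes (s , s₁ , s∈ , s₁∈ , s~s₁)) →
            adjacent-or r∈ s∈ λ a → adjacent-or r∈ s₁∈ λ b → adjacent-or r₁∈ s∈ λ c → adjacent-or r₁∈ s₁∈ λ d →
            ⊥-elim (complete-edges r∈ r₁∈ r~r₁ s∈ s₁∈ s~s₁ a b c d)
      where
      open FrameLemmas F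
      edge? : ∀ S → Dec (∃₂ λ x y → x ∈ˢ S × y ∈ˢ S × x ~ y ≡ true)
      edge? S = Fin.any? λ x → Fin.any? λ y → S x ≟ true ×-dec S y ≟ true ×-dec x ~ y ≟ true
      edgeless : ∀ {S} → ¬ (∃₂ λ x y → x ∈ˢ S × y ∈ˢ S × x ~ y ≡ true) → Indep S
      edgeless none a b = ≢true⇒≡false λ e → none (_ , _ , a , b , e)
      -- In continuation form: a non-adjacent pair yields the conclusion at once, so four calls
      -- leave only two edges complete to each other.
      adjacent-or : ∀ {r s} → r ∈ˢ R → s ∈ˢ R* → (r ~ s ≡ true → A) → A
      adjacent-or {r} {s} r∈ s∈ f = case r ~ s ≟ true of λ where
        (yes e) → f e
        (no n) → let r≁s = ≢true⇒≡false n in case non-adjacent-p⊎q r∈ s∈ r≁s of λ where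
          (inj₁ p~r) → non-adjacent F r∈ s∈ r≁s p~r (non-adjacent-pair r∈ s∈ r≁s p~r)
          -- Swapping the twins preserves `R` and `R*`.
          (inj₂ q~r) → non-adjacent (swap F) r∈ s∈ r≁s q~r
            (FrameLemmas.non-adjacent-pair (swap F) r∈ s∈ r≁s q~r)

    -- From the wheel to the bound

    frame : InducedSub T5Wheel G → Frame
    frame (f , _ , e) = record { φ = f ; φ-adj = λ i j → ≡-sym (e i j) }

    -- Excludes clique numbers below 3.
    frame-triangle : Frame → full has-clique 3
    frame-triangle F = φ (# p′) , refl , φ (# q′) , φ-adj (# p′) (# q′) , φ (# 2′) ,
        ∈∩ {full ∩ (φ (# p′) ~_)} {φ (# q′) ~_} (φ-adj (# p′) (# 2′)) (φ-adj (# q′) (# 2′)) , tt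
      where open Frame F

    clique-prefix : ∀ {S k m} → k ≤ m → S has-clique m → S has-clique k
    clique-prefix z≤n _ = tt
    clique-prefix (s≤s k≤m) (x , p , c) = x , p , clique-prefix k≤m c

  weaken : ∀ {k m} → k ≤ m → Colourable full k → Colourable full m
  weaken k≤m c = record { colour = λ x → inject≤ (colour c x) k≤m ; listed = λ _ → tt
    ; proper = λ p q e → proper c p q e ∘ Fin.inject≤-injective _ _ _ _ }

  Colourable⇒ChiLe : ∀ {k} → Colourable full k → ChiLe G k
  Colourable⇒ChiLe c = colour c , λ u v → proper c refl refl

theorem3p6 : ∀ {n} (G : Graph n) → Connected G →
    Free P5 G → Free HVN G → InducedSub T5Wheel G →
    ∀ (ω : ℕ) → IsCliqueNumber G ω → ChiLe G (ω + 3)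
theorem3p6 G conn free₁ free₂ wheel ω (_ , ncl) =
  subst (ChiLe G) (ℕ.+-comm 3 ω) (Colourable⇒ChiLe G (bound ω ncl))
  where
  F = frame G free₁ free₂ wheel
  small : ∀ {k} → k ≤ 3 → HasClique G k
  small k≤3 = let c = clique-prefix G free₁ free₂ k≤3 (frame-triangle G free₁ free₂ F)
                  f , cl , _ = clique⇒HasClique G _ c in f , cl
  bound : ∀ ω → (HasClique G (suc ω) → ⊥) → Colourable G (full G) (3 + ω)
  bound 0 ncl = ⊥-elim (ncl (small (s≤s z≤n)))
  bound 1 ncl = ⊥-elim (ncl (small (s≤s (s≤s z≤n))))
  bound 2 ncl = ⊥-elim (ncl (small ℕ.≤-refl))
  -- A neighbourhood may need three colours, so `colourable-large` would apply only with `k` equal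
  -- to 2 and give 7 colours, one too many.
  bound 3 ncl = by-frame G free₁ free₂
    (λ F → FrameLemmas.colourable-small G free₁ free₂ F conn ncl)
    (λ F a b c d e → FrameLemmas.NonAdjacentPair.colourable G free₁ free₂ F a b c d e conn ℕ.≤-refl
      (λ c₅ → ncl (drop c₅)))
    F
    where
    drop : HasClique G 5 → HasClique G 4
    drop (f , inj , all) = f ∘ inject₁ , Fin.inject₁-injective ∘ inj ,
      λ i j ne → all _ _ (ne ∘ Fin.inject₁-injective)
  -- The lemmas are used with ω - 2 for their `k`: this gives ω + 3 colours in the first case and ω
  -- + 2 in the second.
  bound (suc (suc (suc (suc k)))) ncl = by-frame G free₁ free₂
    (λ F → FrameLemmas.colourable-large G free₁ free₂ F conn (s≤s (s≤s z≤n)) ncl)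
    (λ F a b c d e → weaken G (ℕ.n≤1+n _)
      (FrameLemmas.NonAdjacentPair.colourable G free₁ free₂ F a b c d e conn (s≤s (s≤s z≤n)) ncl))
    F
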